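{- Let $N\ge1$, $T\ge1$, $1\le S\le T$ be integers. The $S\mapsto S-1$ algorithm described in the context is precisely the $S\mapsto S-1$ Markov step defined by the matrix $P^S_{S\mapsto S-1}$ (defined in the context). That is, if $X\in\Omega(N,T,S)$ and $Y=(Y(0),\dots,Y(T))$ is the random sequence produced from $X$ by the algorithm, then for every $Y'\in\Omega(N,T,S-1)$, $$\mathrm{Prob}\{Y=Y'\}=P^S_{S\mapsto S-1}(X,Y').$$
   Context: Fix integers $N\ge1$, $T\ge1$. For an integer $0\le S\le T$, $\Omega(N,T,S)$ is the set of families of $N$ non-intersecting lattice paths $\tau_1,\dots,\tau_N:\{0,1,\dots,T\}\to\mathbb Z$ with $\tau_i(0)=i-1$, $\tau_i(T)=S+i-1$, $\tau_i(t+1)-\tau_i(t)\in\{0,1\}$ and $\tau_1(t)<\dots<\tau_N(t)$ for all $t$. Such a family is identified with the sequence $X=(X(0),X(1),\dots,X(T))$, $X(t)=(\tau_1(t),\dots,\tau_N(t))$. For $0\le S,t\le T$ put $$\mathfrak X^{S,t}=\{x\in\mathbb Z:\max(0,t+S-T)\le x\le\min(t+N-1,S+N-1)\},$$ $$\mathcal X^{S,t}=\{(x_1,\dots,x_N)\in(\mathfrak X^{S,t})^N: x_1<\dots<x_N\}.$$ Notation: $(a)_k=a(a+1)\cdots(a+k-1)$. Matrix $P^{S,t}_{t+}$ ($0\le t\le T-1$), of size $|\mathcal X^{S,t}|\times|\mathcal X^{S,t+1}|$: $$P^{S,t}_{t+}(X,Y)=\frac{\prod_{i<j}(y_j-y_i)\prod_{i:y_i=x_i+1}(N+S-x_i-1)\prod_{i:y_i=x_i}(x_i+T-t-S)}{(T-t)_N\prod_{i<j}(x_j-x_i)}$$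 if $y_i-x_i\in\{0,1\}$ for all $i$, and $0$ otherwise. Matrix $P^{S,t}_{S+}$ ($0\le S\le T-1$), of size $|\mathcal X^{S,t}|\times|\mathcal X^{S+1,t}|$: $$P^{S,t}_{S+}(X,Y)=\frac{\prod_{i<j}(y_j-y_i)\prod_{i:y_i=x_i+1}(N+t-x_i-1)\prod_{i:y_i=x_i}(x_i+T-t-S)}{(T-S)_N\prod_{i<j}(x_j-x_i)}$$ if $y_i-x_i\in\{0,1\}$ for all $i$, and $0$ otherwise. For $1\le S\le T$, $X\in\Omega(N,T,S)$, $Y\in\Omega(N,T,S-1)$ define $$P^S_{S\mapsto S-1}(X,Y)=\prod_{t=0}^{T-1}\frac{P^{S-1,t}_{t+}(Y(t),Y(t+1))\,P^{S-1,t+1}_{S+}(Y(t+1),X(t+1))}{(P^{S-1,t}_{t+}P^{S-1,t+1}_{S+})(Y(t),X(t+1))}$$ if $\prod_{t=0}^{T-1}(P^{S-1,t}_{t+}P^{S-1,t+1}_{S+})(Y(t),X(t+1))>0$, and $0$ otherwise. $D(a,b,n)$ denotes the probability distribution on $\{0,1,\dots,n\}$ given by $$D(a,b,n)\{k\}=\frac{(a)_k/(b)_k}{\sum_{j=0}^n (a)_j/(b)_j}=\frac{a(a+1)\cdots(a+k-1)\,(b+k)\cdots(b+n-1)}{\sum_{j=0}^{n}a(a+1)\cdots(a+j-1)\,(b+j)\cdots(b+n-1)}.$$ Algorithm ($S\mapsto S-1$). Input $X=(X(0),\dots,X(T))\in\Omega(N,T,S)$. Set $Y(0)=(0,1,\dots,N-1)$.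 For $t=0,1,\dots,T-1$ successively, construct $Y(t+1)=(z_1<\dots<z_N)$, with $z_i\in\mathfrak X^{S-1,t+1}$, from $Y(t)=(y_1<\dots<y_N)$ and $X(t+1)=(x_1<\dots<x_N)$ as follows. ($Y(t)$ and $X(t+1)$ satisfy $(P^{S-1,t}_{t+}P^{S-1,t+1}_{S+})(Y(t),X(t+1))>0$, so $x_i-y_i\in\{0,1,2\}$ for every $i$.) (1) For all $i$ with $x_i-y_i=0$ set $z_i=x_i$. (2) For all $i$ with $x_i-y_i=2$ set $z_i=y_i+1$. (3) Take all remaining $i$, i.e. those with $x_i=y_i+1$, and divide the corresponding integers $x_i$ into maximal blocks of consecutive integers. A block with smallest element $k$ and size $l$ is called a $(k,l)'$-block; thus $x_i=y_i+1=k,\ x_{i+1}=y_{i+1}+1=k+1,\ \dots,\ x_{i+l-1}=y_{i+l-1}+1=k+l-1$. For each $(k,l)'$-block take a random variable $\xi$ distributed according to $D(N+t-k+1,\,N+S-k-1,\,l)$; the variables $\xi$ corresponding to different blocks are independent. Set $z_i=y_i$ for the first $\xi$ integers of the block (their coordinates are $k-1,k,\dots,k+\xi-2$), and $z_i=y_i+1$ for the rest of the block.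
   Formalization: In step (3) the law of ξ is taken to be D(−(N+t−k+1), −(N+S−k−1), l) instead of D(N+t−k+1, N+S−k−1, l); with the positive parameters the claim fails, e.g. for N=2, S=T=1, X=((0,1),(1,2)). -}

module Defs where

open import Data.Bool.Base using (if_then_else_)
open import Data.Fin.Base as Fin using (Fin; toℕ; inject₁; fromℕ)
open import Data.Integer as ℤ using (ℤ; +_; 0ℤ; 1ℤ)
open import Data.List.Base as List using (List; []; _∷_)
open import Data.Nat.Base as ℕ using (ℕ; zero; suc; _∸_)
import Data.Nat.Properties as ℕ
open import Data.Product.Base using (_×_; _,_; proj₁; proj₂; map₂)
open import Data.Rational as ℚ using (ℚ; 0ℚ; 1ℚ)
open import Data.Sum.Base using (_⊎_)
open import Data.Vec.Base as Vec using (Vec; []; _∷_; lookup; tabulate; _++_)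
open import Data.Vec.Properties using (≡-dec)
open import Data.Vec.Relation.Unary.Linked using (Linked; linked?)
open import Relation.Binary.Definitions using (DecidableEquality)
open import Relation.Binary.PropositionalEquality using (_≡_)
open import Relation.Nullary.Decidable using (Dec; yes; no; does; _×-dec_)

------------------------------------------------------------------------
-- Arithmetic

fromℤ : ℤ → ℚ
fromℤ i = i ℚ./ 1

-- Division made total by p ⊘ 0 = 0.  In the quotients below this value is
-- never taken at the arguments that matter: the points of a configuration
-- are distinct, the Pochhammer symbols (T − t)_N and (T − S)_N are only used
-- for t, S < T, the Markov step divides only after testing positivity, and
-- the normalising sum of D is nonzero for every block that can occur.
_⊘_ : ℚ → ℚ → ℚ
p ⊘ q with q ℚ.≟ 0ℚ
... | yes _   = 0ℚ
... | no  q≢0 = ℚ._÷_ p q {{ℚ.≢-nonZero q≢0}}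

infixl 7 _⊘_

∑ : {A : Set} → List A → (A → ℚ) → ℚ
∑ xs f = List.foldr (λ x s → f x ℚ.+ s) 0ℚ xs

∏ : {A : Set} → List A → (A → ℚ) → ℚ
∏ xs f = List.foldr (λ x s → f x ℚ.* s) 1ℚ xs

poch : ℤ → ℕ → ℤ
poch a zero    = 1ℤ
poch a (suc k) = poch a k ℤ.* (a ℤ.+ + k)

∏ᵥ : ∀ {n} → Vec ℤ n → ℤ
∏ᵥ = Vec.foldr _ ℤ._*_ 1ℤ

-- ∏_{i<j} (x_j − x_i)
vandermonde : ∀ {n} → Vec ℤ n → ℤ
vandermonde []       = 1ℤ
vandermonde (x ∷ xs) = ∏ᵥ (Vec.map (λ y → y ℤ.- x) xs) ℤ.* vandermonde xs

------------------------------------------------------------------------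
-- Configurations and families of paths

Config : ℕ → Set
Config N = Vec ℤ N

_≟ᶜ_ : ∀ {N} → DecidableEquality (Config N)
_≟ᶜ_ = ≡-dec ℤ._≟_

Sequence : ℕ → ℕ → Set
Sequence N T = Vec (Config N) (suc T)

_≟ˢ_ : ∀ {N T} → DecidableEquality (Sequence N T)
_≟ˢ_ = ≡-dec _≟ᶜ_

-- X ∈ Ω(N,T,S), with paths numbered from 0: τ_{i+1}(t) = lookup (lookup X t) i.
record Ω (N T S : ℕ) (X : Sequence N T) : Set where
  field
    start  : ∀ (i : Fin N) → lookup (lookup X Fin.zero) i ≡ + toℕ i
    end    : ∀ (i : Fin N) → lookup (lookup X (fromℕ T)) i ≡ + S ℤ.+ + toℕ i
    step   : ∀ (t : Fin T) (i : Fin N) →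
             let d = lookup (lookup X (Fin.suc t)) i ℤ.- lookup (lookup X (inject₁ t)) i
             in d ≡ 0ℤ ⊎ d ≡ 1ℤ
    strict : ∀ (t : Fin (suc T)) (i j : Fin N) → i Fin.< j →
             lookup (lookup X t) i ℤ.< lookup (lookup X t) j

InSection : (N T S t : ℕ) → ℤ → Set
InSection N T S t x =
    (0ℤ ℤ.⊔ (+ t ℤ.+ + S ℤ.- + T)) ℤ.≤ x
  × x ℤ.≤ ((+ t ℤ.+ + N ℤ.- 1ℤ) ℤ.⊓ (+ S ℤ.+ + N ℤ.- 1ℤ))

inSection? : (N T S t : ℕ) (x : ℤ) → Dec (InSection N T S t x)
inSection? N T S t x = (_ ℤ.≤? x) ×-dec (x ℤ.≤? _)

-- Every integer satisfying InSection lies in {0, …, S+N−1}, so enumerating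
-- that range and filtering lists 𝔛^{S,t} without repetition.
section : (N T S t : ℕ) → List ℤ
section N T S t =
  List.filter (inSection? N T S t) (List.map +_ (List.upTo (S ℕ.+ N)))

tuples : {A : Set} (n : ℕ) → List A → List (Vec A n)
tuples zero    xs = [] ∷ []
tuples (suc n) xs = List.cartesianProductWith _∷_ xs (tuples n xs)

-- 𝒳^{S,t}, without repetition
configs : (N T S t : ℕ) → List (Config N)
configs N T S t = List.filter (linked? ℤ._<?_) (tuples N (section N T S t))

------------------------------------------------------------------------
-- The transition matrices

-- A coordinate with y − x ∉ {0,1} contributes the factor 0, which makes the
-- whole matrix entry vanish.
coordFactor : (up stay : ℤ → ℤ) → ℤ → ℤ → ℤ
coordFactor up stay x y =
  if does (y ℤ.≟ x ℤ.+ 1ℤ) then up x else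
  if does (y ℤ.≟ x)        then stay x else 0ℤ

transition : ∀ {N} (up stay : ℤ → ℤ) (den : ℤ) → Config N → Config N → ℚ
transition up stay den x y =
  fromℤ (vandermonde y ℤ.* ∏ᵥ (Vec.zipWith (coordFactor up stay) x y))
    ⊘ fromℤ (den ℤ.* vandermonde x)

P-t+ : (N T S t : ℕ) → Config N → Config N → ℚ
P-t+ N T S t = transition
  (λ x → + N ℤ.+ + S ℤ.- x ℤ.- 1ℤ)
  (λ x → x ℤ.+ + T ℤ.- + t ℤ.- + S)
  (poch (+ T ℤ.- + t) N)

P-S+ : (N T S t : ℕ) → Config N → Config N → ℚ
P-S+ N T S t = transition
  (λ x → + N ℤ.+ + t ℤ.- x ℤ.- 1ℤ)
  (λ x → x ℤ.+ + T ℤ.- + t ℤ.- + S)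
  (poch (+ T ℤ.- + S) N)

-- The matrix product P^{S,t}_{t+} P^{S,t+1}_{S+}
P-t+S+ : (N T S t : ℕ) → Config N → Config N → ℚ
P-t+S+ N T S t y x =
  ∑ (configs N T S (suc t)) λ z → P-t+ N T S t y z ℚ.* P-S+ N T S (suc t) z x

-- P^S_{S↦S−1}(X,Y), for S ≥ 1
P-S↦S-1 : (N T S : ℕ) → Sequence N T → Sequence N T → ℚ
P-S↦S-1 N T S X Y =
  if does (0ℚ ℚ.<? ∏ (List.allFin T) normaliser)
  then ∏ (List.allFin T) (λ t → weight t ⊘ normaliser t)
  else 0ℚ
  where
  normaliser weight : Fin T → ℚ
  normaliser t =
    P-t+S+ N T (S ∸ 1) (toℕ t) (lookup Y (inject₁ t)) (lookup X (Fin.suc t))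
  weight t =
    P-t+ N T (S ∸ 1) (toℕ t) (lookup Y (inject₁ t)) (lookup Y (Fin.suc t)) ℚ.*
    P-S+ N T (S ∸ 1) (suc (toℕ t)) (lookup Y (Fin.suc t)) (lookup X (Fin.suc t))

------------------------------------------------------------------------
-- Finitely supported distributions

-- A list of outcomes with their weights; an outcome may occur repeatedly,
-- its probability being the sum of the weights of its occurrences.
Dist : Set → Set
Dist A = List (A × ℚ)

return : {A : Set} → A → Dist A
return a = (a , 1ℚ) ∷ []

_>>=_ : {A B : Set} → Dist A → (A → Dist B) → Dist B
d >>= f = List.concatMap (λ (a , p) → List.map (map₂ (p ℚ.*_)) (f a)) d

infixl 1 _>>=_

Prob : {A : Set} → DecidableEquality A → Dist A → A → ℚ
Prob _≟_ d a = ∑ (List.filter (λ o → proj₁ o ≟ a) d) proj₂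

-- D(a,b,n){k} = (a)_k (b+k)_{n−k} / ∑_j (a)_j (b+j)_{n−j}
D : (a b : ℤ) (n : ℕ) → Dist (Fin (suc n))
D a b n = List.map (λ k → k , weight k ⊘ ∑ (List.allFin (suc n)) weight)
                   (List.allFin (suc n))
  where
  weight : Fin (suc n) → ℚ
  weight k = fromℤ (poch a (toℕ k) ℤ.* poch (b ℤ.+ + toℕ k) (n ∸ toℕ k))

------------------------------------------------------------------------
-- The algorithm

-- The particles, from left to right: `fixed z` is one whose new coordinate z
-- is determined; `block k l` is a maximal block of l particles with
-- x = y + 1, whose x-coordinates are k, k+1, …, k+l−1.
data Blocks : ℕ → Set where
  []    : Blocks 0
  fixed : ∀ {n} → ℤ → Blocks n → Blocks (suc n)
  block : ∀ {n} (k : ℤ) (l : ℕ) → Blocks n → Blocks (l ℕ.+ n)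

-- Adds on the left a particle with x = y + 1, joining it to the leading block
-- when that block starts at x + 1.
extend : ∀ {n} → ℤ → Blocks n → Blocks (suc n)
extend x (block k l bs) =
  if does (k ℤ.≟ x ℤ.+ 1ℤ) then block x (suc l) bs else block x 1 (block k l bs)
extend x bs             = block x 1 bs

-- Under the hypotheses x − y ∈ {0,1,2} always, so the last case is x = y + 2.
-- As x is increasing, integers adjacent in a block have adjacent indices.
decompose : ∀ {n} → (y x : Config n) → Blocks n
decompose []       []       = []
decompose (y ∷ ys) (x ∷ xs) =
  if does (x ℤ.≟ y)         then fixed x (decompose ys xs) else
  if does (x ℤ.≟ y ℤ.+ 1ℤ)  then extend x (decompose ys xs) else
  fixed (y ℤ.+ 1ℤ) (decompose ys xs)

-- The first ξ particles of the block stay at y = k−1, …, k+ξ−2; the others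
-- move to y + 1 = k+ξ, …, k+l−1.
moveBlock : (k : ℤ) (l ξ : ℕ) → Vec ℤ l
moveBlock k l ξ = tabulate λ m →
  if does (toℕ m ℕ.<? ξ) then k ℤ.+ + toℕ m ℤ.- 1ℤ else k ℤ.+ + toℕ m

-- The law of ξ.  The particle of the block with y = k−1+m enters
-- P^{S−1,t}_{t+} P^{S−1,t+1}_{S+} with the factor N+t−k+1−m if it first stays
-- and N+S−k−1−m if it first moves, up to a common factor.  These decrease
-- with m, while (a)_j increases, so the parameters of D are the negatives
-- −(N+t−k+1) and −(N+S−k−1); the signs cancel in the quotient.  With positive
-- signs the law would be different for every l ≥ 2.
blockLaw : (N S t : ℕ) (k : ℤ) (l : ℕ) → Dist (Fin (suc l))
blockLaw N S t k l =
  D (ℤ.- (+ N ℤ.+ + t ℤ.- k ℤ.+ 1ℤ)) (ℤ.- (+ N ℤ.+ + S ℤ.- k ℤ.- 1ℤ)) l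

-- Each block draws its own ξ, independently of the others.
sampleBlocks : (N S t : ℕ) → ∀ {n} → Blocks n → Dist (Vec ℤ n)
sampleBlocks N S t []             = return []
sampleBlocks N S t (fixed z bs)   =
  sampleBlocks N S t bs >>= λ zs → return (z ∷ zs)
sampleBlocks N S t (block k l bs) =
  blockLaw N S t k l    >>= λ ξ →
  sampleBlocks N S t bs >>= λ zs →
  return (moveBlock k l (toℕ ξ) ++ zs)

-- The law of Y(t+1) given Y(t) = y and X(t+1) = x
algorithmStep : (N S t : ℕ) → Config N → Config N → Dist (Config N)
algorithmStep N S t y x = sampleBlocks N S t (decompose y x)

-- The law of (Y(t), …, Y(t+n)) given Y(t) = y and (X(t+1), …, X(t+n))
algorithmFrom : (N S t : ℕ) → ∀ {n} →
                Config N → Vec (Config N) n → Dist (Vec (Config N) (suc n))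
algorithmFrom N S t y []       = return (y ∷ [])
algorithmFrom N S t y (x ∷ xs) =
  algorithmStep N S t y x          >>= λ z  →
  algorithmFrom N S (suc t) z xs   >>= λ zs →
  return (y ∷ zs)

algorithm : (N T S : ℕ) → Sequence N T → Dist (Sequence N T)
algorithm N T S X = algorithmFrom N S 0 (tabulate λ i → + toℕ i) (Vec.tail X)

{-# OPTIONS --safe #-}
module Submission where

-- Fix Y(t) = y and X(t+1) = x.  In the product of the two transition entries
-- through an intermediate configuration z the Vandermonde determinant of z
-- cancels, leaving a product over particles.  A particle with x − y ≠ 1
-- contributes a single z; one with x = y + 1 contributes a common factor times
-- N+t−y (it first stays) or N+S−1−y−1 (it first moves).  Strict monotonicity of z
-- constrains only particles of the same block, where those staying must
-- precede those moving, so z ↦ weight is proportional to the law of the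
-- algorithm.  Summing over z identifies the constant with the normaliser.
--
-- The normaliser at (Y(t), X(t+1)) is positive as soon as x − y ∈ {0,1,2}
-- coordinatewise.  Along a sequence this persists for as long as the weights
-- are nonzero, because P_{S+}(Y(t+1), X(t+1)) ≠ 0 gives X(t+1) − Y(t+1) ∈ {0,1}
-- and X makes steps in {0,1}; a vanishing weight makes both sides zero.

open import Defs
open import Data.Nat.Base using (ℕ; _≤_; _∸_)
open import Relation.Binary.PropositionalEquality using (_≡_)
open import Algebra.Bundles using (CommutativeMonoid)
open import Algebra.Properties.CommutativeSemigroup using (x∙yz≈y∙xz; xy∙z≈xz∙y; interchange)
open import Data.Bool.Base using (true; false; if_then_else_)
open import Data.Empty using (⊥; ⊥-elim)
open import Data.Fin.Base as Fin using (Fin; toℕ; inject₁; fromℕ)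
import Data.Fin.Properties as Fin
open import Data.Integer.Base as ℤ using (ℤ; +_; 0ℤ; 1ℤ; -1ℤ)
import Data.Integer.Properties as ℤ
open import Data.Integer.Tactic.RingSolver using (solve-∀)
open import Data.List.Base as List using (List; []; _∷_)
open import Data.List.Membership.Propositional using (_∈_)
open import Data.List.Membership.Propositional.Properties using (∈-filter⁺; ∈-filter⁻; ∈-map⁺; ∈-upTo⁺; ∈-cartesianProductWith⁺)
import Data.List.Properties as List
import Data.List.Relation.Unary.All as ListAll
import Data.List.Relation.Unary.AllPairs as AllPairs
open import Data.List.Relation.Unary.Any using (here; there)
open import Data.List.Relation.Unary.Unique.Propositional using (Unique)
import Data.List.Relation.Unary.Unique.Propositional.Properties as Unique
open import Data.Nat.Base as ℕ using (zero; suc; z≤n; s≤s)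
import Data.Nat.Properties as ℕ
open import Data.Product.Base using (_×_; _,_; proj₁; proj₂; ∃-syntax)
open import Data.Rational as ℚ using (ℚ; 0ℚ; 1ℚ)
import Data.Rational.Properties as ℚ
import Data.Rational.Unnormalised.Base as ℚᵘ
import Data.Rational.Unnormalised.Properties as ℚᵘ
open import Data.Sum.Base using (_⊎_; inj₁; inj₂)
open import Data.Unit.Base using (⊤; tt)
open import Data.Vec.Base as Vec using (Vec; []; _∷_; tabulate; _++_; lookup; head)
open import Data.Vec.Properties using (∷-injectiveˡ; ∷-injectiveʳ; ∷-injective; tabulate∘lookup; tabulate-cong)
open import Data.Vec.Relation.Binary.Pointwise.Inductive using (Pointwise; []; _∷_)
open import Data.Vec.Relation.Unary.All as All using (All; []; _∷_)
open import Data.Vec.Relation.Unary.Linked using (Linked; []; [-]; _∷_; linked?)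
import Data.Vec.Relation.Unary.Linked.Properties as Linked
open import Function.Base using (_∘_)
open import Relation.Binary.Definitions using (DecidableEquality)
open import Relation.Binary.PropositionalEquality using (_≢_; refl; sym; trans; cong; cong₂; subst; subst₂; ≢-sym; module ≡-Reasoning)
open import Relation.Nullary.Decidable using (Dec; yes; no; does; dec-true; dec-false)
open import Relation.Nullary.Negation using (¬_; contradiction)

-- Two obstacles shape the argument. The factor N+S-k-1 of a particle that moves first vanishes when
-- k is the rightmost site S+N-1, so `D` can give weight zero to some values of ξ, and these are the
-- values whose configurations leave 𝒳^{S-1,t+1}. The sum over 𝒳^{S-1,t+1} can be matched with the
-- total mass of the law only after such values are discarded; hence the support is defined by
-- nonvanishing weights, and membership in 𝒳^{S-1,t+1} is proved on that support alone. The other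
-- obstacle is normalisation. The law is a product of quotients, one for each block, with numerators
-- and denominators of sign (-1)^l, whereas the Markov step has a single quotient for each time.
-- Both are compared with one unnormalised law that has nonnegative weights on the blocks that
-- occur, in identities with the masses multiplied out; the only quotient to be resolved at the end
-- is that of the Markov step.

private
  *-comm-semigroup = CommutativeMonoid.commutativeSemigroup ℚ.*-1-commutativeMonoid
  +-comm-semigroup = CommutativeMonoid.commutativeSemigroup ℚ.+-0-commutativeMonoid

-- Order and sign in the integers.

i<i+1 : ∀ i → i ℤ.< i ℤ.+ 1ℤ
i<i+1 i = subst (ℤ._< i ℤ.+ 1ℤ) (ℤ.+-identityʳ i) (ℤ.+-monoʳ-< i (ℤ.+<+ (s≤s z≤n)))

i<i+2 : ∀ i → i ℤ.< i ℤ.+ 1ℤ ℤ.+ 1ℤ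
i<i+2 i = ℤ.<-trans (i<i+1 i) (i<i+1 (i ℤ.+ 1ℤ))

<⇒+1≤ : ∀ {i j} → i ℤ.< j → i ℤ.+ 1ℤ ℤ.≤ j
<⇒+1≤ {i} i<j = subst (ℤ._≤ _) (ℤ.+-comm 1ℤ i) (ℤ.i<j⇒suc[i]≤j i<j)

+1≤⇒< : ∀ {i j} → i ℤ.+ 1ℤ ℤ.≤ j → i ℤ.< j
+1≤⇒< {i} i+1≤j = ℤ.<-≤-trans (i<i+1 i) i+1≤j

0<i+1 : ∀ {i} → 0ℤ ℤ.≤ i → 0ℤ ℤ.< i ℤ.+ 1ℤ
0<i+1 {i} 0≤i = ℤ.≤-<-trans 0≤i (i<i+1 i)

0<i*j : ∀ {i j} → 0ℤ ℤ.< i → 0ℤ ℤ.< j → 0ℤ ℤ.< i ℤ.* j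
0<i*j {i} {j} 0<i 0<j = subst (ℤ._< i ℤ.* j) (ℤ.*-zeroʳ i) (ℤ.*-monoˡ-<-pos i {{ℤ.positive 0<i}} 0<j)

0≤i*j : ∀ {i j} → 0ℤ ℤ.≤ i → 0ℤ ℤ.≤ j → 0ℤ ℤ.≤ i ℤ.* j
0≤i*j {i} {j} 0≤i 0≤j = subst (ℤ._≤ i ℤ.* j) (ℤ.*-zeroʳ i) (ℤ.*-monoˡ-≤-nonNeg i {{ℤ.nonNegative 0≤i}} 0≤j)

0<i+1⇒0≤i : ∀ {i} → 0ℤ ℤ.< i ℤ.+ 1ℤ → 0ℤ ℤ.≤ i
0<i+1⇒0≤i {+ _}              _         = ℤ.+≤+ z≤n
0<i+1⇒0≤i {ℤ.-[1+ zero ]}  (ℤ.+<+ ())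
0<i+1⇒0≤i {ℤ.-[1+ suc _ ]} ()

i<j⇒0<j-i : ∀ {i j} → i ℤ.< j → 0ℤ ℤ.< j ℤ.- i
i<j⇒0<j-i {i} {j} i<j = subst (ℤ._< j ℤ.- i) (ℤ.+-inverseʳ i) (ℤ.+-monoˡ-< (ℤ.- i) i<j)

i+1-1≡i : ∀ i → i ℤ.+ 1ℤ ℤ.- 1ℤ ≡ i
i+1-1≡i = solve-∀

i-1+1≡i : ∀ i → i ℤ.- 1ℤ ℤ.+ 1ℤ ≡ i
i-1+1≡i = solve-∀

i-1≢i : ∀ i → i ℤ.- 1ℤ ≢ i
i-1≢i i eq = ℤ.<⇒≢ (i<i+1 (i ℤ.- 1ℤ)) (trans eq (sym (i-1+1≡i i)))

-- The embedding of the integers in the rationals, and total division.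

fromℤ-* : ∀ i j → fromℤ (i ℤ.* j) ≡ fromℤ i ℚ.* fromℤ j
fromℤ-* i j = ℚ.toℚᵘ-injective (begin
  ℚ.toℚᵘ (fromℤ (i ℤ.* j))                ≈⟨ ℚ.toℚᵘ-fromℚᵘ (ℚᵘ.mkℚᵘ (i ℤ.* j) 0) ⟩
  ℚᵘ.mkℚᵘ i 0 ℚᵘ.* ℚᵘ.mkℚᵘ j 0            ≈⟨ ℚᵘ.*-cong (ℚ.toℚᵘ-fromℚᵘ (ℚᵘ.mkℚᵘ i 0)) (ℚ.toℚᵘ-fromℚᵘ (ℚᵘ.mkℚᵘ j 0)) ⟨
  ℚ.toℚᵘ (fromℤ i) ℚᵘ.* ℚ.toℚᵘ (fromℤ j)  ≈⟨ ℚ.toℚᵘ-homo-* (fromℤ i) (fromℤ j) ⟨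
  ℚ.toℚᵘ (fromℤ i ℚ.* fromℤ j)            ∎)
  where open ℚᵘ.≃-Reasoning

fromℤ-nonNeg : ∀ {i} → 0ℤ ℤ.≤ i → 0ℚ ℚ.≤ fromℤ i
fromℤ-nonNeg {+ n} _ = ℚ.nonNegative⁻¹ _ {{ℚ.normalize-nonNeg n 1}}

fromℤ-pos : ∀ {i} → 0ℤ ℤ.< i → 0ℚ ℚ.< fromℤ i
fromℤ-pos {+ suc n} _ = ℚ.positive⁻¹ _ {{ℚ.normalize-pos (suc n) 1}}
fromℤ-pos {+ zero} (ℤ.+<+ ())

pos⇒≢0 : ∀ {p} → 0ℚ ℚ.< p → p ≢ 0ℚ
pos⇒≢0 0<p refl = ℚ.<-irrefl refl 0<p

0<p*q : ∀ {p q} → 0ℚ ℚ.< p → 0ℚ ℚ.< q → 0ℚ ℚ.< p ℚ.* q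
0<p*q {p} {q} 0<p 0<q =
  ℚ.positive⁻¹ _ {{ℚ.pos*pos⇒pos p {{ℚ.positive 0<p}} q {{ℚ.positive 0<q}}}}

⊘-* : ∀ p {q} → q ≢ 0ℚ → (p ⊘ q) ℚ.* q ≡ p
⊘-* p {q} q≢0 with q ℚ.≟ 0ℚ
... | yes q≡0 = contradiction q≡0 q≢0
... | no q≢0′ = begin
  p ℚ.* 1/q ℚ.* q     ≡⟨ ℚ.*-assoc p 1/q q ⟩
  p ℚ.* (1/q ℚ.* q)   ≡⟨ cong (p ℚ.*_) (ℚ.*-inverseˡ q {{ℚ.≢-nonZero q≢0′}}) ⟩
  p ℚ.* 1ℚ            ≡⟨ ℚ.*-identityʳ p ⟩
  p                   ∎
  where
  open ≡-Reasoning
  1/q = ℚ.1/_ q {{ℚ.≢-nonZero q≢0′}}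

*-cancelʳ : ∀ {p q r} → r ≢ 0ℚ → p ℚ.* r ≡ q ℚ.* r → p ≡ q
*-cancelʳ {p} {q} {r} r≢0 pr≡qr = begin
  p                     ≡⟨ undo p ⟨
  p ℚ.* r ℚ.* 1/r       ≡⟨ cong (ℚ._* 1/r) pr≡qr ⟩
  q ℚ.* r ℚ.* 1/r       ≡⟨ undo q ⟩
  q                     ∎
  where
  open ≡-Reasoning
  instance _ = ℚ.≢-nonZero r≢0
  1/r = ℚ.1/ r
  undo : ∀ s → s ℚ.* r ℚ.* 1/r ≡ s
  undo s = trans (ℚ.*-assoc s r 1/r)
    (trans (cong (s ℚ.*_) (ℚ.*-inverseʳ r)) (ℚ.*-identityʳ s))

⊘-unique : ∀ {p q r} → q ≢ 0ℚ → r ℚ.* q ≡ p → p ⊘ q ≡ r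
⊘-unique {p} q≢0 rq≡p = *-cancelʳ q≢0 (trans (⊘-* p q≢0) (sym rq≡p))

⊘-pos : ∀ {p q} → 0ℚ ℚ.< p → 0ℚ ℚ.< q → 0ℚ ℚ.< p ⊘ q
⊘-pos {p} {q} 0<p 0<q = ℚ.*-cancelʳ-<-nonNeg q {{ℚ.nonNegative (ℚ.<⇒≤ 0<q)}}
  (subst₂ ℚ._<_ (sym (ℚ.*-zeroˡ q)) (sym (⊘-* p (pos⇒≢0 0<q))) 0<p)

-- The default value of `⊘` makes this hold at `q` = 0 as well, so a vanishing numerator kills a
-- matrix entry without any condition on its denominator.
0⊘ : ∀ q → 0ℚ ⊘ q ≡ 0ℚ
0⊘ q with q ℚ.≟ 0ℚ
... | yes _   = refl
... | no  q≢0 = ℚ.*-zeroˡ (ℚ.1/_ q {{ℚ.≢-nonZero q≢0}})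

-- Indicators and finite sums.

ind : {P : Set} → Dec P → ℚ
ind P? = if does P? then 1ℚ else 0ℚ

ind-yes : {P : Set} (P? : Dec P) → P → ind P? ≡ 1ℚ
ind-yes P? p = cong (if_then 1ℚ else 0ℚ) (dec-true P? p)

ind-no : {P : Set} (P? : Dec P) → ¬ P → ind P? ≡ 0ℚ
ind-no P? ¬p = cong (if_then 1ℚ else 0ℚ) (dec-false P? ¬p)

ind-⇔ : {P Q : Set} (P? : Dec P) (Q? : Dec Q) → (P → Q) → (Q → P) → ind P? ≡ ind Q?
ind-⇔ P? (yes q) to from = ind-yes P? (from q)
ind-⇔ P? (no ¬q) to from = ind-no P? (¬q ∘ to)

module _ {A : Set} where

  ∑-cong : ∀ (xs : List A) {f g} → (∀ x → f x ≡ g x) → ∑ xs f ≡ ∑ xs g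
  ∑-cong []       f≗g = refl
  ∑-cong (x ∷ xs) f≗g = cong₂ ℚ._+_ (f≗g x) (∑-cong xs f≗g)

  ∑-cong-∈ : ∀ (xs : List A) {f g} → (∀ {x} → x ∈ xs → f x ≡ g x) → ∑ xs f ≡ ∑ xs g
  ∑-cong-∈ []       f≗g = refl
  ∑-cong-∈ (x ∷ xs) f≗g = cong₂ ℚ._+_ (f≗g (here refl)) (∑-cong-∈ xs (f≗g ∘ there))

  ∑-++ : ∀ (xs ys : List A) f → ∑ (xs List.++ ys) f ≡ ∑ xs f ℚ.+ ∑ ys f
  ∑-++ []       ys f = sym (ℚ.+-identityˡ _)
  ∑-++ (x ∷ xs) ys f =
    trans (cong (f x ℚ.+_) (∑-++ xs ys f)) (sym (ℚ.+-assoc (f x) (∑ xs f) (∑ ys f)))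

  ∑-map : ∀ {B : Set} (h : B → A) xs f → ∑ (List.map h xs) f ≡ ∑ xs (f ∘ h)
  ∑-map h []       f = refl
  ∑-map h (x ∷ xs) f = cong (f (h x) ℚ.+_) (∑-map h xs f)

  ∏-map : ∀ {B : Set} (h : B → A) xs f → ∏ (List.map h xs) f ≡ ∏ xs (f ∘ h)
  ∏-map h []       f = refl
  ∏-map h (x ∷ xs) f = cong (f (h x) ℚ.*_) (∏-map h xs f)

  ∑-zero : ∀ (xs : List A) → ∑ xs (λ _ → 0ℚ) ≡ 0ℚ
  ∑-zero []       = refl
  ∑-zero (x ∷ xs) = trans (ℚ.+-identityˡ _) (∑-zero xs)

  ∑-distribˡ : ∀ (xs : List A) c f → ∑ xs (λ x → c ℚ.* f x) ≡ c ℚ.* ∑ xs f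
  ∑-distribˡ []       c f = sym (ℚ.*-zeroʳ c)
  ∑-distribˡ (x ∷ xs) c f =
    trans (cong (c ℚ.* f x ℚ.+_) (∑-distribˡ xs c f)) (sym (ℚ.*-distribˡ-+ c (f x) (∑ xs f)))

  ∑-distribʳ : ∀ (xs : List A) c f → ∑ xs (λ x → f x ℚ.* c) ≡ ∑ xs f ℚ.* c
  ∑-distribʳ xs c f =
    trans (∑-cong xs (λ x → ℚ.*-comm (f x) c)) (trans (∑-distribˡ xs c f) (ℚ.*-comm c _))

  ∑-+ : ∀ (xs : List A) f g → ∑ xs (λ x → f x ℚ.+ g x) ≡ ∑ xs f ℚ.+ ∑ xs g
  ∑-+ []       f g = refl
  ∑-+ (x ∷ xs) f g =
    trans (cong (f x ℚ.+ g x ℚ.+_) (∑-+ xs f g))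
          (interchange +-comm-semigroup (f x) (g x) (∑ xs f) (∑ xs g))

  module _ (_≟_ : DecidableEquality A) where
    ∑-ind-∉ : ∀ {a} xs → ListAll.All (a ≢_) xs → ∑ xs (λ x → ind (a ≟ x)) ≡ 0ℚ
    ∑-ind-∉ []       ListAll.[]             = refl
    ∑-ind-∉ (x ∷ xs) (a≢x ListAll.∷ a≢xs) = cong₂ ℚ._+_ (ind-no (_ ≟ x) a≢x) (∑-ind-∉ xs a≢xs)

    -- Absence of repetitions makes the count exactly one. Applied to the list `configs`, this turns
    -- a sum over configurations into a total mass.
    ∑-ind-∈ : ∀ {a xs} → Unique xs → a ∈ xs → ∑ xs (λ x → ind (a ≟ x)) ≡ 1ℚ
    ∑-ind-∈ {a} {x ∷ xs} (x≢xs AllPairs.∷ _) (here refl) =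
      cong₂ ℚ._+_ (ind-yes (a ≟ a) refl) (∑-ind-∉ xs x≢xs)
    ∑-ind-∈ {a} {x ∷ xs} (x≢xs AllPairs.∷ u) (there a∈xs) =
      cong₂ ℚ._+_ (ind-no (a ≟ x) λ { refl → ListAll.lookup x≢xs a∈xs refl }) (∑-ind-∈ u a∈xs)

∑-swap : ∀ {A B : Set} (xs : List A) (ys : List B) (f : A → B → ℚ) →
         ∑ xs (λ x → ∑ ys (f x)) ≡ ∑ ys (λ y → ∑ xs (λ x → f x y))
∑-swap []       ys f = sym (∑-zero ys)
∑-swap (x ∷ xs) ys f =
  trans (cong (∑ ys (f x) ℚ.+_) (∑-swap xs ys f)) (sym (∑-+ ys (f x) (λ y → ∑ xs (λ x′ → f x′ y))))

-- Finitely supported distributions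

𝔼 : {A : Set} → Dist A → (A → ℚ) → ℚ
𝔼 d f = ∑ d (λ o → proj₂ o ℚ.* f (proj₁ o))

module _ {A : Set} where

  𝔼-cong : ∀ (d : Dist A) {f g} → (∀ a → f a ≡ g a) → 𝔼 d f ≡ 𝔼 d g
  𝔼-cong d f≗g = ∑-cong d (λ o → cong (proj₂ o ℚ.*_) (f≗g (proj₁ o)))

  𝔼-return : ∀ (a : A) f → 𝔼 (return a) f ≡ f a
  𝔼-return a f = trans (ℚ.+-identityʳ _) (ℚ.*-identityˡ (f a))

  𝔼->>= : ∀ {B : Set} (d : Dist B) (f : B → Dist A) g →
          𝔼 (d >>= f) g ≡ 𝔼 d (λ b → 𝔼 (f b) g)
  𝔼->>= []            f g = refl
  𝔼->>= ((b , p) ∷ d) f g = begin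
    ∑ (List.map scale (f b) List.++ (d >>= f)) h  ≡⟨ ∑-++ (List.map scale (f b)) (d >>= f) h ⟩
    ∑ (List.map scale (f b)) h ℚ.+ 𝔼 (d >>= f) g  ≡⟨ cong₂ ℚ._+_ head-eq (𝔼->>= d f g) ⟩
    p ℚ.* 𝔼 (f b) g ℚ.+ 𝔼 d (λ b → 𝔼 (f b) g)    ∎
    where
    open ≡-Reasoning
    scale = λ (o : A × ℚ) → proj₁ o , p ℚ.* proj₂ o
    h = λ (o : A × ℚ) → proj₂ o ℚ.* g (proj₁ o)
    head-eq : ∑ (List.map scale (f b)) h ≡ p ℚ.* 𝔼 (f b) g
    head-eq = trans (∑-map scale (f b) h)
      (trans (∑-cong (f b) (λ o → ℚ.*-assoc p (proj₂ o) _)) (∑-distribˡ (f b) p h))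

  𝔼-* : ∀ (d : Dist A) f c → 𝔼 d (λ a → f a ℚ.* c) ≡ 𝔼 d f ℚ.* c
  𝔼-* d f c = trans (∑-cong d (λ o → sym (ℚ.*-assoc (proj₂ o) (f (proj₁ o)) c))) (∑-distribʳ d c (λ o → proj₂ o ℚ.* f (proj₁ o)))

  𝔼-zero : ∀ (d : Dist A) → 𝔼 d (λ _ → 0ℚ) ≡ 0ℚ
  𝔼-zero d = trans (∑-cong d (λ o → ℚ.*-zeroʳ (proj₂ o))) (∑-zero d)

  -- Unlike `Prob`, an expectation passes through `>>=` for every test function, so all laws are
  -- computed as expectations and only translated back at the end.
  Prob≡𝔼 : ∀ (_≟_ : DecidableEquality A) d a → Prob _≟_ d a ≡ 𝔼 d (λ b → ind (b ≟ a))
  Prob≡𝔼 _≟_ []            a = refl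
  Prob≡𝔼 _≟_ ((b , p) ∷ d) a with does (b ≟ a)
  ... | true  = cong₂ ℚ._+_ (sym (ℚ.*-identityʳ p)) (Prob≡𝔼 _≟_ d a)
  ... | false = trans (Prob≡𝔼 _≟_ d a)
    (sym (trans (cong (ℚ._+ _) (ℚ.*-zeroʳ p)) (ℚ.+-identityˡ _)))

∑-allFin-suc : ∀ n (f : Fin (suc n) → ℚ) →
  ∑ (List.allFin (suc n)) f ≡ f Fin.zero ℚ.+ ∑ (List.allFin n) (f ∘ Fin.suc)
∑-allFin-suc n f = cong (f Fin.zero ℚ.+_)
  (trans (cong (λ xs → ∑ xs f) (sym (List.map-tabulate (λ i → i) Fin.suc)))
         (∑-map Fin.suc (List.allFin n) f))

-- Point masses, increasing vectors, and recursions that peel off the leftmost particle.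

δ : ∀ {n} → Config n → Config n → ℚ
δ z a = ind (a ≟ᶜ z)

δ-∷ : ∀ {n} a {z} {zs as : Config n} → a ≡ z → δ (z ∷ zs) (a ∷ as) ≡ δ zs as
δ-∷ a {zs = zs} {as} refl =
  ind-⇔ ((a ∷ as) ≟ᶜ (a ∷ zs)) (as ≟ᶜ zs) ∷-injectiveʳ (cong (a ∷_))

δ-∷-≢ : ∀ {n a z} {zs as : Config n} → a ≢ z → δ (z ∷ zs) (a ∷ as) ≡ 0ℚ
δ-∷-≢ {a = a} {z} {zs} {as} a≢z = ind-no ((a ∷ as) ≟ᶜ (z ∷ zs)) (a≢z ∘ ∷-injectiveˡ)

Below : ∀ {n} → ℤ → Config n → Set
Below z []       = ⊤
Below z (x ∷ _) = z ℤ.< x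

infixr 5 _∷ˡ_
_∷ˡ_ : ∀ {n z} {zs : Config n} → Below z zs → Linked ℤ._<_ zs → Linked ℤ._<_ (z ∷ zs)
_∷ˡ_ {zs = []}    _   _  = [-]
_∷ˡ_ {zs = _ ∷ _} z<  zs = z< ∷ zs

unlink : ∀ {n z} {zs : Config n} → Linked ℤ._<_ (z ∷ zs) → Below z zs × Linked ℤ._<_ zs
unlink {zs = []}    _         = tt , []
unlink {zs = _ ∷ _} (z< ∷ zs) = z< , zs

below-≤ : ∀ {n y} {ys zs : Config n} → Below y ys → Pointwise ℤ._≤_ ys zs → Below y zs
below-≤ _    []          = tt
below-≤ y<y′ (y′≤z ∷ _) = ℤ.<-≤-trans y<y′ y′≤z

moveBlock-zero : ∀ k l → moveBlock k (suc l) 0 ≡ k ∷ moveBlock (k ℤ.+ 1ℤ) l 0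
moveBlock-zero k l = cong₂ _∷_ (ℤ.+-identityʳ k)
  (tabulate-cong λ m → sym (ℤ.+-assoc k 1ℤ (+ toℕ m)))

-- Replacing `k` by `k + 1` absorbs the shift of the index, so what follows a staying first particle
-- is again a block move, with one particle and one stay fewer.
moveBlock-suc : ∀ k l ξ →
  moveBlock k (suc l) (suc ξ) ≡ k ℤ.- 1ℤ ∷ moveBlock (k ℤ.+ 1ℤ) l ξ
moveBlock-suc k l ξ = cong₂ _∷_ (cong (ℤ._- 1ℤ) (ℤ.+-identityʳ k))
  (tabulate-cong λ m → cong₂ (λ a b → if does (toℕ m ℕ.<? ξ) then a ℤ.- 1ℤ else b)
    (sym (ℤ.+-assoc k 1ℤ (+ toℕ m))) (sym (ℤ.+-assoc k 1ℤ (+ toℕ m))))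

-- `poch` grows at its last factor, whereas the recursion along a block removes the first one.
poch-suc : ∀ a k → poch a (suc k) ≡ a ℤ.* poch (a ℤ.+ 1ℤ) k
poch-suc a zero    = ring a
  where
  ring : ∀ a → 1ℤ ℤ.* (a ℤ.+ 0ℤ) ≡ a ℤ.* 1ℤ
  ring = solve-∀
poch-suc a (suc k) = begin
  poch a (suc k) ℤ.* (a ℤ.+ + suc k)                ≡⟨ cong (ℤ._* (a ℤ.+ + suc k)) (poch-suc a k) ⟩
  a ℤ.* poch (a ℤ.+ 1ℤ) k ℤ.* (a ℤ.+ (1ℤ ℤ.+ + k))  ≡⟨ ring a (poch (a ℤ.+ 1ℤ) k) (+ k) ⟩
  a ℤ.* (poch (a ℤ.+ 1ℤ) k ℤ.* (a ℤ.+ 1ℤ ℤ.+ + k))  ∎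
  where
  open ≡-Reasoning
  ring : ∀ a p k → a ℤ.* p ℤ.* (a ℤ.+ (1ℤ ℤ.+ k)) ≡ a ℤ.* (p ℤ.* (a ℤ.+ 1ℤ ℤ.+ k))
  ring = solve-∀

-- The law of one step of the algorithm

module Kernel (N S t : ℕ) where

  stayFactor moveFactor : ℤ → ℤ
  stayFactor k = + N ℤ.+ + t ℤ.- k ℤ.+ 1ℤ
  moveFactor k = + N ℤ.+ + S ℤ.- k ℤ.- 1ℤ

  -- (−1)^l times the weight of ξ in D; nonnegative for every block that occurs.
  blockWeight : ℤ → ℕ → ℕ → ℤ
  blockWeight k zero    _       = 1ℤ
  blockWeight k (suc l) zero    = moveFactor k ℤ.* blockWeight (k ℤ.+ 1ℤ) l zero
  blockWeight k (suc l) (suc ξ) = stayFactor k ℤ.* blockWeight (k ℤ.+ 1ℤ) l ξ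

  sign : ℕ → ℤ
  sign l = -1ℤ ℤ.^ l

  private
    sign-pull : ∀ m s w → ℤ.- m ℤ.* (s ℤ.* w) ≡ -1ℤ ℤ.* s ℤ.* (m ℤ.* w)
    sign-pull = solve-∀

  -- Passing to the next particle lowers `stayFactor` and `moveFactor` by one, hence raises their
  -- negatives by one, exactly as successive factors of a Pochhammer symbol grow. Each of the l
  -- particles contributes one sign.
  poch-blockWeight : ∀ k l {ξ} → ξ ≤ l →
    poch (ℤ.- stayFactor k) ξ ℤ.* poch (ℤ.- moveFactor k ℤ.+ + ξ) (l ∸ ξ)
      ≡ sign l ℤ.* blockWeight k l ξ
  poch-blockWeight k zero    z≤n = refl
  poch-blockWeight k (suc l) {zero} z≤n = begin
    1ℤ ℤ.* poch (b ℤ.+ 0ℤ) (suc l)                             ≡⟨ cong (1ℤ ℤ.*_) (poch-suc (b ℤ.+ 0ℤ) l) ⟩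
    1ℤ ℤ.* ((b ℤ.+ 0ℤ) ℤ.* poch (b ℤ.+ 0ℤ ℤ.+ 1ℤ) l)           ≡⟨ cong (λ c → 1ℤ ℤ.* ((b ℤ.+ 0ℤ) ℤ.* poch c l)) (shift (+ N ℤ.+ + S) k) ⟩
    1ℤ ℤ.* ((b ℤ.+ 0ℤ) ℤ.* poch (b′ ℤ.+ 0ℤ) l)                 ≡⟨ regroup (moveFactor k) (poch (b′ ℤ.+ 0ℤ) l) ⟩
    ℤ.- moveFactor k ℤ.* (1ℤ ℤ.* poch (b′ ℤ.+ 0ℤ) l)           ≡⟨ cong (ℤ.- moveFactor k ℤ.*_) (poch-blockWeight (k ℤ.+ 1ℤ) l z≤n) ⟩
    ℤ.- moveFactor k ℤ.* (sign l ℤ.* blockWeight (k ℤ.+ 1ℤ) l 0) ≡⟨ sign-pull (moveFactor k) (sign l) _ ⟩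
    sign (suc l) ℤ.* blockWeight k (suc l) 0                     ∎
    where
    open ≡-Reasoning
    b = ℤ.- moveFactor k
    b′ = ℤ.- moveFactor (k ℤ.+ 1ℤ)
    shift : ∀ c k → ℤ.- (c ℤ.- k ℤ.- 1ℤ) ℤ.+ 0ℤ ℤ.+ 1ℤ ≡ ℤ.- (c ℤ.- (k ℤ.+ 1ℤ) ℤ.- 1ℤ) ℤ.+ 0ℤ
    shift = solve-∀
    regroup : ∀ m p → 1ℤ ℤ.* ((ℤ.- m ℤ.+ 0ℤ) ℤ.* p) ≡ ℤ.- m ℤ.* (1ℤ ℤ.* p)
    regroup = solve-∀
  poch-blockWeight k (suc l) {suc ξ} (s≤s ξ≤l) = begin
    poch a (suc ξ) ℤ.* poch (b ℤ.+ + suc ξ) (l ∸ ξ)               ≡⟨ cong (ℤ._* poch (b ℤ.+ + suc ξ) (l ∸ ξ)) (poch-suc a ξ) ⟩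
    a ℤ.* poch (a ℤ.+ 1ℤ) ξ ℤ.* poch (b ℤ.+ + suc ξ) (l ∸ ξ)      ≡⟨ cong₂ (λ c d → a ℤ.* poch c ξ ℤ.* poch d (l ∸ ξ)) (shiftᵃ (+ N ℤ.+ + t) k) (shiftᵇ (+ N ℤ.+ + S) k (+ ξ)) ⟩
    a ℤ.* poch a′ ξ ℤ.* poch (b′ ℤ.+ + ξ) (l ∸ ξ)                 ≡⟨ ℤ.*-assoc a (poch a′ ξ) _ ⟩
    a ℤ.* (poch a′ ξ ℤ.* poch (b′ ℤ.+ + ξ) (l ∸ ξ))               ≡⟨ cong (a ℤ.*_) (poch-blockWeight (k ℤ.+ 1ℤ) l ξ≤l) ⟩
    a ℤ.* (sign l ℤ.* blockWeight (k ℤ.+ 1ℤ) l ξ)                 ≡⟨ sign-pull (stayFactor k) (sign l) _ ⟩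
    sign (suc l) ℤ.* blockWeight k (suc l) (suc ξ)                ∎
    where
    open ≡-Reasoning
    a = ℤ.- stayFactor k
    a′ = ℤ.- stayFactor (k ℤ.+ 1ℤ)
    b = ℤ.- moveFactor k
    b′ = ℤ.- moveFactor (k ℤ.+ 1ℤ)
    shiftᵃ : ∀ c k → ℤ.- (c ℤ.- k ℤ.+ 1ℤ) ℤ.+ 1ℤ ≡ ℤ.- (c ℤ.- (k ℤ.+ 1ℤ) ℤ.+ 1ℤ)
    shiftᵃ = solve-∀
    shiftᵇ : ∀ c k x → ℤ.- (c ℤ.- k ℤ.- 1ℤ) ℤ.+ (1ℤ ℤ.+ x) ≡ ℤ.- (c ℤ.- (k ℤ.+ 1ℤ) ℤ.- 1ℤ) ℤ.+ x
    shiftᵇ = solve-∀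

  -- ∑_a μ(a) g(a) for the unnormalised law μ of sampleBlocks.
  integral : ∀ {n} → Blocks n → (Config n → ℚ) → ℚ
  integral []             g = g []
  integral (fixed z bs)   g = integral bs (λ zs → g (z ∷ zs))
  integral (block k l bs) g = ∑ (List.allFin (suc l)) λ ξ →
    fromℤ (blockWeight k l (toℕ ξ)) ℚ.* integral bs (λ zs → g (moveBlock k l (toℕ ξ) ++ zs))

  blockMass : ℤ → ℕ → ℚ
  blockMass k l = ∑ (List.allFin (suc l)) λ ξ → fromℤ (blockWeight k l (toℕ ξ))

  mass : ∀ {n} → Blocks n → ℚ
  mass bs = integral bs (λ _ → 1ℚ)

  mass-block : ∀ {n} k l (bs : Blocks n) → mass (block k l bs) ≡ blockMass k l ℚ.* mass bs
  mass-block k l bs = ∑-distribʳ (List.allFin (suc l)) (mass bs) (λ ξ → fromℤ (blockWeight k l (toℕ ξ)))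

  Admissible : ∀ {n} → Blocks n → Set
  Admissible []             = ⊤
  Admissible (fixed _ bs)   = Admissible bs
  Admissible (block k l bs) = 0ℤ ℤ.≤ blockWeight k l 0 × 0ℚ ℚ.< blockMass k l × Admissible bs

  mass-pos : ∀ {n} (bs : Blocks n) → Admissible bs → 0ℚ ℚ.< mass bs
  mass-pos []             _           = ℚ.positive⁻¹ 1ℚ
  mass-pos (fixed _ bs)   adm         = mass-pos bs adm
  mass-pos (block k l bs) (_ , 0<Z , adm) =
    subst (0ℚ ℚ.<_) (sym (mass-block k l bs)) (0<p*q 0<Z (mass-pos bs adm))

  -- The support of the unnormalised law. A configuration is recorded with the ξ of each block that
  -- produced it, and that ξ must have nonzero weight.
  Outcome : ∀ {n} → Blocks n → Config n → Set
  Outcome []             _ = ⊤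
  Outcome (fixed z bs)   a = ∃[ zs ] a ≡ z ∷ zs × Outcome bs zs
  Outcome (block k l bs) a = ∃[ ξ ] ∃[ zs ]
    blockWeight k l (toℕ {suc l} ξ) ≢ 0ℤ × a ≡ moveBlock k l (toℕ ξ) ++ zs × Outcome bs zs

  -- A ξ of weight zero annihilates its term whatever the test function does there, so nothing has
  -- to be known about configurations outside the support.
  integral-cong-Outcome : ∀ {n} (bs : Blocks n) {g h} → (∀ {a} → Outcome bs a → g a ≡ h a) →
                          integral bs g ≡ integral bs h
  integral-cong-Outcome []             g≗h = g≗h tt
  integral-cong-Outcome (fixed z bs)   g≗h =
    integral-cong-Outcome bs (λ o → g≗h (_ , refl , o))
  integral-cong-Outcome (block k l bs) {g} {h} g≗h = ∑-cong (List.allFin (suc l)) term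
    where
    term : ∀ ξ → fromℤ (blockWeight k l (toℕ ξ)) ℚ.* integral bs (λ zs → g (moveBlock k l (toℕ ξ) ++ zs))
               ≡ fromℤ (blockWeight k l (toℕ ξ)) ℚ.* integral bs (λ zs → h (moveBlock k l (toℕ ξ) ++ zs))
    term ξ with blockWeight k l (toℕ ξ) in eq
    ... | w with w ℤ.≟ 0ℤ
    ... | yes refl = trans (ℚ.*-zeroˡ (I g)) (sym (ℚ.*-zeroˡ (I h)))
      where I = λ (f : _ → ℚ) → integral bs (λ zs → f (moveBlock k l (toℕ ξ) ++ zs))
    ... | no  w≢0  = cong (fromℤ w ℚ.*_)
      (integral-cong-Outcome bs λ o → g≗h (ξ , _ , (λ w≡0 → w≢0 (trans (sym eq) w≡0)) , refl , o))

  integral-cong : ∀ {n} (bs : Blocks n) {g h} → (∀ a → g a ≡ h a) → integral bs g ≡ integral bs h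
  integral-cong bs g≗h = integral-cong-Outcome bs (λ {a} _ → g≗h a)

  integral-∑ : ∀ {n} {A : Set} (bs : Blocks n) (xs : List A) (g : A → Config n → ℚ) →
               integral bs (λ a → ∑ xs (λ x → g x a)) ≡ ∑ xs (λ x → integral bs (g x))
  integral-∑ []             xs g = refl
  integral-∑ (fixed z bs)   xs g = integral-∑ bs xs (λ x zs → g x (z ∷ zs))
  integral-∑ (block k l bs) xs g = begin
    ∑ ξs (λ ξ → w ξ ℚ.* integral bs (λ zs → ∑ xs (λ x → g x (v ξ ++ zs))))
      ≡⟨ ∑-cong ξs (λ ξ → trans (cong (w ξ ℚ.*_) (integral-∑ bs xs (λ x zs → g x (v ξ ++ zs))))
                                (sym (∑-distribˡ xs (w ξ) _))) ⟩
    ∑ ξs (λ ξ → ∑ xs (λ x → w ξ ℚ.* integral bs (λ zs → g x (v ξ ++ zs))))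
      ≡⟨ ∑-swap ξs xs (λ ξ x → w ξ ℚ.* integral bs (λ zs → g x (v ξ ++ zs))) ⟩
    ∑ xs (λ x → integral (block k l bs) (g x)) ∎
    where
    open ≡-Reasoning
    ξs = List.allFin (suc l)
    w = λ (ξ : Fin (suc l)) → fromℤ (blockWeight k l (toℕ ξ))
    v = λ (ξ : Fin (suc l)) → moveBlock k l (toℕ ξ)

  integral-zero : ∀ {n} (bs : Blocks n) → integral bs (λ _ → 0ℚ) ≡ 0ℚ
  -- The zero function is a sum over the empty list, so linearity already gives the claim.
  integral-zero bs = integral-∑ bs ([] {A = ⊤}) (λ _ _ → 0ℚ)

  sign≢0 : ∀ l → fromℤ (sign l) ≢ 0ℚ
  sign≢0 zero    = λ ()
  sign≢0 (suc l) eq = sign≢0 l (*-cancelʳ {r = fromℤ -1ℤ} (λ ())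
    (trans (ℚ.*-comm (fromℤ (sign l)) _) (trans (sym (fromℤ-* -1ℤ (sign l))) (trans eq (sym (ℚ.*-zeroˡ (fromℤ -1ℤ)))))))

  -- Numerators and normalising sum of `D` carry the same sign (-1)^l, which cancels in the
  -- quotient. Positivity of the mass makes the normalising sum nonzero, so `⊘` is a true division
  -- here.
  𝔼-blockLaw : ∀ k l → 0ℚ ℚ.< blockMass k l → ∀ g →
    𝔼 (blockLaw N S t k l) g ℚ.* blockMass k l
      ≡ ∑ (List.allFin (suc l)) (λ ξ → fromℤ (blockWeight k l (toℕ ξ)) ℚ.* g ξ)
  𝔼-blockLaw k l 0<Z g = begin
    𝔼 (blockLaw N S t k l) g ℚ.* Z
      ≡⟨ cong (ℚ._* Z) (∑-map (λ ξ → ξ , d ξ ⊘ ∑ ξs d) ξs (λ o → proj₂ o ℚ.* g (proj₁ o))) ⟩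
    ∑ ξs (λ ξ → (d ξ ⊘ ∑ ξs d) ℚ.* g ξ) ℚ.* Z
      ≡⟨ ∑-distribʳ ξs Z (λ ξ → (d ξ ⊘ ∑ ξs d) ℚ.* g ξ) ⟨
    ∑ ξs (λ ξ → (d ξ ⊘ ∑ ξs d) ℚ.* g ξ ℚ.* Z)
      ≡⟨ ∑-cong ξs (λ ξ → trans (xy∙z≈xz∙y *-comm-semigroup (d ξ ⊘ ∑ ξs d) (g ξ) Z) (cong (ℚ._* g ξ) (quotient ξ))) ⟩
    ∑ ξs (λ ξ → w ξ ℚ.* g ξ) ∎
    where
    open ≡-Reasoning
    ξs = List.allFin (suc l)
    Z = blockMass k l
    w d : Fin (suc l) → ℚ
    w ξ = fromℤ (blockWeight k l (toℕ ξ))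
    d ξ = fromℤ (poch (ℤ.- stayFactor k) (toℕ ξ) ℤ.* poch (ℤ.- moveFactor k ℤ.+ + toℕ ξ) (l ∸ toℕ ξ))
    c = fromℤ (sign l)
    d≡cw : ∀ ξ → d ξ ≡ c ℚ.* w ξ
    d≡cw ξ = trans (cong fromℤ (poch-blockWeight k l (Fin.toℕ≤pred[n] ξ))) (fromℤ-* (sign l) _)
    ∑d≡cZ : ∑ ξs d ≡ c ℚ.* Z
    ∑d≡cZ = trans (∑-cong ξs d≡cw) (∑-distribˡ ξs c w)
    cZ≢0 : ∑ ξs d ≢ 0ℚ
    cZ≢0 eq = sign≢0 l (*-cancelʳ (pos⇒≢0 0<Z) (trans (sym ∑d≡cZ) (trans eq (sym (ℚ.*-zeroˡ Z)))))
    quotient : ∀ ξ → (d ξ ⊘ ∑ ξs d) ℚ.* Z ≡ w ξ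
    quotient ξ = *-cancelʳ (sign≢0 l) (begin
      (d ξ ⊘ ∑ ξs d) ℚ.* Z ℚ.* c    ≡⟨ trans (ℚ.*-assoc (d ξ ⊘ ∑ ξs d) Z c) (cong ((d ξ ⊘ ∑ ξs d) ℚ.*_) (ℚ.*-comm Z c)) ⟩
      (d ξ ⊘ ∑ ξs d) ℚ.* (c ℚ.* Z)  ≡⟨ cong ((d ξ ⊘ ∑ ξs d) ℚ.*_) ∑d≡cZ ⟨
      (d ξ ⊘ ∑ ξs d) ℚ.* ∑ ξs d     ≡⟨ ⊘-* (d ξ) cZ≢0 ⟩
      d ξ                           ≡⟨ trans (d≡cw ξ) (ℚ.*-comm c (w ξ)) ⟩
      w ξ ℚ.* c                     ∎)

  -- Since the blocks draw independently, the total mass is the product of the block masses, and the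
  -- normalisation is undone one block at a time.
  𝔼-sampleBlocks : ∀ {n} (bs : Blocks n) → Admissible bs → ∀ g →
    𝔼 (sampleBlocks N S t bs) g ℚ.* mass bs ≡ integral bs g
  𝔼-sampleBlocks []           _   g = trans (ℚ.*-identityʳ _) (𝔼-return [] g)
  𝔼-sampleBlocks (fixed z bs) adm g = trans
    (cong (ℚ._* mass bs) (trans (𝔼->>= (sampleBlocks N S t bs) (λ zs → return (z ∷ zs)) g)
      (𝔼-cong (sampleBlocks N S t bs) (λ zs → 𝔼-return (z ∷ zs) g))))
    (𝔼-sampleBlocks bs adm (λ zs → g (z ∷ zs)))
  𝔼-sampleBlocks (block k l bs) (_ , 0<Z , adm) g = begin
    𝔼 (sampleBlocks N S t (block k l bs)) g ℚ.* mass (block k l bs)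
      ≡⟨ cong₂ ℚ._*_ unfold (mass-block k l bs) ⟩
    𝔼 law e ℚ.* (blockMass k l ℚ.* mass bs)
      ≡⟨ trans (sym (ℚ.*-assoc (𝔼 law e) _ _)) (cong (ℚ._* mass bs) (𝔼-blockLaw k l 0<Z e)) ⟩
    ∑ ξs (λ ξ → w ξ ℚ.* e ξ) ℚ.* mass bs
      ≡⟨ ∑-distribʳ ξs (mass bs) (λ ξ → w ξ ℚ.* e ξ) ⟨
    ∑ ξs (λ ξ → w ξ ℚ.* e ξ ℚ.* mass bs)
      ≡⟨ ∑-cong ξs (λ ξ → trans (ℚ.*-assoc (w ξ) (e ξ) (mass bs))
           (cong (w ξ ℚ.*_) (𝔼-sampleBlocks bs adm (λ zs → g (moveBlock k l (toℕ ξ) ++ zs))))) ⟩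
    integral (block k l bs) g ∎
    where
    open ≡-Reasoning
    ξs = List.allFin (suc l)
    law = blockLaw N S t k l
    w e : Fin (suc l) → ℚ
    w ξ = fromℤ (blockWeight k l (toℕ ξ))
    e ξ = 𝔼 (sampleBlocks N S t bs) (λ zs → g (moveBlock k l (toℕ ξ) ++ zs))
    unfold : 𝔼 (sampleBlocks N S t (block k l bs)) g ≡ 𝔼 law e
    unfold = trans (𝔼->>= law (λ ξ → sampleBlocks N S t bs >>= λ zs → return (moveBlock k l (toℕ ξ) ++ zs)) g) (𝔼-cong law λ ξ →
      trans (𝔼->>= (sampleBlocks N S t bs) (λ zs → return (moveBlock k l (toℕ ξ) ++ zs)) g)
        (𝔼-cong (sampleBlocks N S t bs) (λ zs → 𝔼-return (moveBlock k l (toℕ ξ) ++ zs) g)))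

  integral-block-zero : ∀ {n} k (bs : Blocks n) g → integral (block k 0 bs) g ≡ integral bs g
  integral-block-zero k bs g = trans (ℚ.+-identityʳ _) (ℚ.*-identityˡ _)

  -- The leftmost particle separates ξ = 0 from ξ > 0. If it moves, the whole block moves; if it
  -- stays, the remaining particles form a block of the same kind starting at `k + 1`. Every
  -- induction along a block rests on this split.
  integral-block-suc : ∀ {n} k l (bs : Blocks n) g → integral (block k (suc l) bs) g ≡
    fromℤ (moveFactor k) ℚ.* (fromℤ (blockWeight (k ℤ.+ 1ℤ) l 0) ℚ.*
      integral bs (λ zs → g (k ∷ moveBlock (k ℤ.+ 1ℤ) l 0 ++ zs)))
    ℚ.+ fromℤ (stayFactor k) ℚ.* integral (block (k ℤ.+ 1ℤ) l bs) (λ zs → g (k ℤ.- 1ℤ ∷ zs))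
  integral-block-suc k l bs g = trans (∑-allFin-suc (suc l) term) (cong₂ ℚ._+_ head-term tail-terms)
    where
    k′ = k ℤ.+ 1ℤ
    term = λ (ξ : Fin (suc (suc l))) → fromℤ (blockWeight k (suc l) (toℕ ξ)) ℚ.*
      integral bs (λ zs → g (moveBlock k (suc l) (toℕ ξ) ++ zs))
    pull : ∀ a b c → fromℤ (a ℤ.* b) ℚ.* c ≡ fromℤ a ℚ.* (fromℤ b ℚ.* c)
    pull a b c = trans (cong (ℚ._* c) (fromℤ-* a b)) (ℚ.*-assoc (fromℤ a) (fromℤ b) c)
    head-term : fromℤ (blockWeight k (suc l) 0) ℚ.* integral bs (λ zs → g (moveBlock k (suc l) 0 ++ zs))
      ≡ fromℤ (moveFactor k) ℚ.* (fromℤ (blockWeight k′ l 0) ℚ.*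
          integral bs (λ zs → g (k ∷ moveBlock k′ l 0 ++ zs)))
    head-term = trans (cong (λ v → fromℤ (blockWeight k (suc l) 0) ℚ.* integral bs (λ zs → g (v ++ zs)))
                         (moveBlock-zero k l))
                      (pull (moveFactor k) (blockWeight k′ l 0) _)
    tail-terms : ∑ (List.allFin (suc l)) (λ ξ → fromℤ (blockWeight k (suc l) (suc (toℕ ξ))) ℚ.*
                   integral bs (λ zs → g (moveBlock k (suc l) (suc (toℕ ξ)) ++ zs)))
      ≡ fromℤ (stayFactor k) ℚ.* integral (block k′ l bs) (λ zs → g (k ℤ.- 1ℤ ∷ zs))
    tail-terms = trans (∑-cong (List.allFin (suc l)) λ ξ →
        trans (cong (λ v → fromℤ (blockWeight k (suc l) (suc (toℕ ξ))) ℚ.* integral bs (λ zs → g (v ++ zs)))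
                 (moveBlock-suc k l (toℕ ξ)))
              (pull (stayFactor k) (blockWeight k′ l (toℕ ξ)) _))
      (∑-distribˡ (List.allFin (suc l)) (fromℤ (stayFactor k)) _)

  integral-δ-∷ : ∀ {n} (bs : Blocks n) a {z} {zs} → a ≡ z →
                 integral bs (λ as → δ (z ∷ zs) (a ∷ as)) ≡ integral bs (δ zs)
  integral-δ-∷ bs a {zs = zs} a≡z = integral-cong bs (λ as → δ-∷ a {zs = zs} {as} a≡z)

  integral-δ-∷-≢ : ∀ {m n} (bs : Blocks n) (v : Config n → Config m) {a z} {zs} → a ≢ z →
                   integral bs (λ as → δ (z ∷ zs) (a ∷ v as)) ≡ 0ℚ
  integral-δ-∷-≢ bs v {zs = zs} a≢z = trans (integral-cong bs (λ as → δ-∷-≢ {zs = zs} {v as} a≢z)) (integral-zero bs)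

  module _ {n : ℕ} (k : ℤ) (l : ℕ) (bs : Blocks n) {z : ℤ} {zs : Config (l ℕ.+ n)} where

    private
      k′ = k ℤ.+ 1ℤ
      p = fromℤ (stayFactor k)
      q = fromℤ (moveFactor k)
      moved-term stay-term : ℚ
      moved-term = fromℤ (blockWeight k′ l 0) ℚ.* integral bs (λ as → δ (z ∷ zs) (k ∷ moveBlock k′ l 0 ++ as))
      stay-term = integral (block k′ l bs) (λ as → δ (z ∷ zs) (k ℤ.- 1ℤ ∷ as))

      split : integral (block k (suc l) bs) (δ (z ∷ zs)) ≡ q ℚ.* moved-term ℚ.+ p ℚ.* stay-term
      split = integral-block-suc k l bs (δ (z ∷ zs))

      no-move : k ≢ z → moved-term ≡ 0ℚ
      no-move k≢z = trans
        (cong (fromℤ (blockWeight k′ l 0) ℚ.*_) (integral-δ-∷-≢ bs (moveBlock k′ l 0 ++_) {zs = zs} k≢z))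
        (ℚ.*-zeroʳ (fromℤ (blockWeight k′ l 0)))

      no-stay : k ℤ.- 1ℤ ≢ z → stay-term ≡ 0ℚ
      no-stay k-1≢z = integral-δ-∷-≢ (block k′ l bs) (λ as → as) {zs = zs} k-1≢z

    integral-δ-stay : z ≡ k ℤ.- 1ℤ →
      integral (block k (suc l) bs) (δ (z ∷ zs)) ≡ p ℚ.* integral (block k′ l bs) (δ zs)
    integral-δ-stay z≡k-1 = trans split (trans
      (cong₂ (λ a b → q ℚ.* a ℚ.+ p ℚ.* b) (no-move (λ k≡z → i-1≢i k (sym (trans k≡z z≡k-1))))
        (integral-δ-∷ (block k′ l bs) (k ℤ.- 1ℤ) {zs = zs} (sym z≡k-1)))
      (trans (cong (ℚ._+ p ℚ.* integral (block k′ l bs) (δ zs)) (ℚ.*-zeroʳ q)) (ℚ.+-identityˡ _)))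

    integral-δ-none : z ≢ k ℤ.- 1ℤ → z ≢ k → integral (block k (suc l) bs) (δ (z ∷ zs)) ≡ 0ℚ
    integral-δ-none z≢k-1 z≢k = trans split (trans
      (cong₂ (λ a b → q ℚ.* a ℚ.+ p ℚ.* b) (no-move (≢-sym z≢k)) (no-stay (≢-sym z≢k-1)))
      (cong₂ ℚ._+_ (ℚ.*-zeroʳ q) (ℚ.*-zeroʳ p)))

  -- As zs lies to the right of k, only ξ = 0 contributes.
  integral-δ-above : ∀ {n} k l (bs : Blocks n) {zs : Config (l ℕ.+ n)} → Below k zs →
    fromℤ (blockWeight (k ℤ.+ 1ℤ) l 0) ℚ.* integral bs (λ as → δ zs (moveBlock (k ℤ.+ 1ℤ) l 0 ++ as))
      ≡ integral (block (k ℤ.+ 1ℤ) l bs) (δ zs)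
  integral-δ-above k zero    bs _ = sym (ℚ.+-identityʳ _)
  integral-δ-above k (suc l) bs {z ∷ zs} k<z = sym (begin
    integral (block k′ (suc l) bs) (δ (z ∷ zs))
      ≡⟨ ∑-allFin-suc (suc l) term ⟩
    term Fin.zero ℚ.+ ∑ (List.allFin (suc l)) (term ∘ Fin.suc)
      ≡⟨ cong (term Fin.zero ℚ.+_) (trans (∑-cong (List.allFin (suc l)) vanish) (∑-zero (List.allFin (suc l)))) ⟩
    term Fin.zero ℚ.+ 0ℚ
      ≡⟨ ℚ.+-identityʳ _ ⟩
    term Fin.zero ∎)
    where
    open ≡-Reasoning
    k′ = k ℤ.+ 1ℤ
    term = λ (ξ : Fin (suc (suc l))) → fromℤ (blockWeight k′ (suc l) (toℕ ξ)) ℚ.*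
      integral bs (λ as → δ (z ∷ zs) (moveBlock k′ (suc l) (toℕ ξ) ++ as))
    vanish : ∀ ξ → term (Fin.suc ξ) ≡ 0ℚ
    vanish ξ = trans
      (cong (fromℤ (blockWeight k′ (suc l) (suc (toℕ ξ))) ℚ.*_)
        (trans (cong (λ v → integral bs (λ as → δ (z ∷ zs) (v ++ as))) (moveBlock-suc k′ l (toℕ ξ)))
          (integral-δ-∷-≢ bs (moveBlock (k′ ℤ.+ 1ℤ) l (toℕ ξ) ++_) {zs = zs}
            (λ eq → ℤ.<-irrefl (trans (sym (i+1-1≡i k)) eq) k<z))))
      (ℚ.*-zeroʳ (fromℤ (blockWeight k′ (suc l) (suc (toℕ ξ)))))

  -- Strict monotonicity of the target enters here. After a first particle that moves, only the term
  -- in which all others move is present; the missing terms of the shorter block would put the next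
  -- particle at `k`, so they vanish at `zs` and may be added. On increasing targets the law thus
  -- factors over particles, as the path weight does.
  integral-δ-move : ∀ {n} k l (bs : Blocks n) {zs : Config (l ℕ.+ n)} → Below k zs →
    integral (block k (suc l) bs) (δ (k ∷ zs))
      ≡ fromℤ (moveFactor k) ℚ.* integral (block (k ℤ.+ 1ℤ) l bs) (δ zs)
  integral-δ-move k l bs {zs} k<zs = begin
    integral (block k (suc l) bs) (δ (k ∷ zs))
      ≡⟨ integral-block-suc k l bs (δ (k ∷ zs)) ⟩
    q ℚ.* (w ℚ.* integral bs (λ as → δ (k ∷ zs) (k ∷ v ++ as))) ℚ.+
      p ℚ.* integral (block k′ l bs) (λ as → δ (k ∷ zs) (k ℤ.- 1ℤ ∷ as))
      ≡⟨ cong₂ (λ a b → q ℚ.* (w ℚ.* a) ℚ.+ p ℚ.* b)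
           (integral-cong bs (λ as → δ-∷ k {zs = zs} {v ++ as} refl))
           (integral-δ-∷-≢ (block k′ l bs) (λ as → as) {zs = zs} (i-1≢i k)) ⟩
    q ℚ.* (w ℚ.* integral bs (λ as → δ zs (v ++ as))) ℚ.+ p ℚ.* 0ℚ
      ≡⟨ cong₂ (λ a b → q ℚ.* a ℚ.+ b) (integral-δ-above k l bs k<zs) (ℚ.*-zeroʳ p) ⟩
    q ℚ.* integral (block k′ l bs) (δ zs) ℚ.+ 0ℚ
      ≡⟨ ℚ.+-identityʳ _ ⟩
    q ℚ.* integral (block k′ l bs) (δ zs) ∎
    where
    open ≡-Reasoning
    k′ = k ℤ.+ 1ℤ
    p = fromℤ (stayFactor k)
    q = fromℤ (moveFactor k)
    w = fromℤ (blockWeight k′ l 0)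
    v = moveBlock k′ l 0

-- The weights of intermediate configurations

module _ (up stay : ℤ → ℤ) (x : ℤ) {y : ℤ} where
  coordFactor-up : y ≡ x ℤ.+ 1ℤ → coordFactor up stay x y ≡ up x
  coordFactor-up y≡x+1 rewrite dec-true (y ℤ.≟ x ℤ.+ 1ℤ) y≡x+1 = refl

  coordFactor-none : y ≢ x ℤ.+ 1ℤ → y ≢ x → coordFactor up stay x y ≡ 0ℤ
  coordFactor-none y≢x+1 y≢x
    rewrite dec-false (y ℤ.≟ x ℤ.+ 1ℤ) y≢x+1 | dec-false (y ℤ.≟ x) y≢x = refl

  coordFactor-stay : y ≡ x → coordFactor up stay x y ≡ stay x
  coordFactor-stay y≡x
    rewrite dec-false (y ℤ.≟ x ℤ.+ 1ℤ) (λ y≡x+1 → ℤ.<⇒≢ (i<i+1 x) (trans (sym y≡x) y≡x+1))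
          | dec-true (y ℤ.≟ x) y≡x = refl

UpStep : ℤ → ℤ → Set
UpStep x y = y ≡ x ⊎ y ≡ x ℤ.+ 1ℤ

Displacement : ℤ → ℤ → Set
Displacement y x = x ≡ y ⊎ x ≡ y ℤ.+ 1ℤ ⊎ x ≡ y ℤ.+ 1ℤ ℤ.+ 1ℤ

-- S′ plays the role of S − 1.
module Step (N S′ T t : ℕ) where

  open Kernel N (suc S′) t

  up₁ stay₁ up₂ stay₂ : ℤ → ℤ
  up₁   x = + N ℤ.+ + S′ ℤ.- x ℤ.- 1ℤ
  stay₁ x = x ℤ.+ + T ℤ.- + t ℤ.- + S′
  up₂   x = + N ℤ.+ + suc t ℤ.- x ℤ.- 1ℤ
  stay₂ x = x ℤ.+ + T ℤ.- + suc t ℤ.- + S′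

  factor : ℤ → ℤ → ℤ → ℤ
  factor y z x = coordFactor up₁ stay₁ y z ℤ.* coordFactor up₂ stay₂ z x

  factors : ∀ {n} → Config n → Config n → Config n → ℤ
  factors []       []       []       = 1ℤ
  factors (y ∷ ys) (z ∷ zs) (x ∷ xs) = factor y z x ℤ.* factors ys zs xs

  factors-∏ : ∀ {n} (y z x : Config n) →
    ∏ᵥ (Vec.zipWith (coordFactor up₁ stay₁) y z) ℤ.* ∏ᵥ (Vec.zipWith (coordFactor up₂ stay₂) z x)
      ≡ factors y z x
  factors-∏ []       []       []       = refl
  factors-∏ (y ∷ ys) (z ∷ zs) (x ∷ xs) = trans
    (ring (coordFactor up₁ stay₁ y z) (∏ᵥ (Vec.zipWith (coordFactor up₁ stay₁) ys zs))
          (coordFactor up₂ stay₂ z x) (∏ᵥ (Vec.zipWith (coordFactor up₂ stay₂) zs xs)))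
    (cong (factor y z x ℤ.*_) (factors-∏ ys zs xs))
    where
    ring : ∀ a b c d → a ℤ.* b ℤ.* (c ℤ.* d) ≡ a ℤ.* c ℤ.* (b ℤ.* d)
    ring = solve-∀

  -- y ∈ 𝔛^{S−1,t} and x ∈ 𝔛^{S,t+1}, up to x ≥ 0.
  record Site (y x : ℤ) : Set where
    field
      y≥0     : 0ℤ ℤ.≤ y
      y≤t+N-1 : y ℤ.≤ + t ℤ.+ + N ℤ.- 1ℤ
      stay₁≥0 : 0ℤ ℤ.≤ stay₁ y
      up₁≥0   : 0ℤ ℤ.≤ up₁ y
      stay₂>0 : 0ℤ ℤ.< stay₂ x
      move≥0  : 0ℤ ℤ.≤ moveFactor x
      stay>0  : 0ℤ ℤ.< stayFactor x

  open Site

  up₁≡move : ∀ y → up₁ y ≡ moveFactor (y ℤ.+ 1ℤ)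
  up₁≡move = ring (+ N) (+ S′)
    where
    ring : ∀ n s y → n ℤ.+ s ℤ.- y ℤ.- 1ℤ ≡ n ℤ.+ (1ℤ ℤ.+ s) ℤ.- (y ℤ.+ 1ℤ) ℤ.- 1ℤ
    ring = solve-∀

  up₂≡stay : ∀ y → up₂ y ≡ stayFactor (y ℤ.+ 1ℤ)
  up₂≡stay = ring (+ N) (+ t)
    where
    ring : ∀ n u y → n ℤ.+ (1ℤ ℤ.+ u) ℤ.- y ℤ.- 1ℤ ≡ n ℤ.+ u ℤ.- (y ℤ.+ 1ℤ) ℤ.+ 1ℤ
    ring = solve-∀

  -- The factor of a particle that stays depends on position minus time only. This is why a particle
  -- with x = y + 1 has the same such factor in both orders of its two steps.
  stay₁≡stay₂ : ∀ y → stay₁ y ≡ stay₂ (y ℤ.+ 1ℤ)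
  stay₁≡stay₂ = ring (+ T) (+ t) (+ S′)
    where
    ring : ∀ T u s y → y ℤ.+ T ℤ.- u ℤ.- s ≡ y ℤ.+ 1ℤ ℤ.+ T ℤ.- (1ℤ ℤ.+ u) ℤ.- s
    ring = solve-∀

  stay₁≡stay₂+1 : ∀ y → stay₁ y ≡ stay₂ y ℤ.+ 1ℤ
  stay₁≡stay₂+1 = ring (+ T) (+ t) (+ S′)
    where
    ring : ∀ T u s y → y ℤ.+ T ℤ.- u ℤ.- s ≡ y ℤ.+ T ℤ.- (1ℤ ℤ.+ u) ℤ.- s ℤ.+ 1ℤ
    ring = solve-∀

  move-pred : ∀ y → moveFactor y ≡ moveFactor (y ℤ.+ 1ℤ) ℤ.+ 1ℤ
  move-pred = ring (+ N ℤ.+ + suc S′)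
    where
    ring : ∀ n y → n ℤ.- y ℤ.- 1ℤ ≡ n ℤ.- (y ℤ.+ 1ℤ) ℤ.- 1ℤ ℤ.+ 1ℤ
    ring = solve-∀

  factor-stay : ∀ {y z} → z ≡ y → factor y z y ≡ stay₁ y ℤ.* stay₂ y
  factor-stay {y} refl = cong₂ ℤ._*_ (coordFactor-stay up₁ stay₁ y refl) (coordFactor-stay up₂ stay₂ y refl)

  factor-zeroˡ : ∀ {y z x} → z ≢ y ℤ.+ 1ℤ → z ≢ y → factor y z x ≡ 0ℤ
  factor-zeroˡ {y} {z} {x} z≢y+1 z≢y = trans
    (cong (ℤ._* coordFactor up₂ stay₂ z x) (coordFactor-none up₁ stay₁ y z≢y+1 z≢y)) (ℤ.*-zeroˡ (coordFactor up₂ stay₂ z x))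

  factor-zeroʳ : ∀ {y z x} → x ≢ z ℤ.+ 1ℤ → x ≢ z → factor y z x ≡ 0ℤ
  factor-zeroʳ {y} {z} {x} x≢z+1 x≢z = trans
    (cong (coordFactor up₁ stay₁ y z ℤ.*_) (coordFactor-none up₂ stay₂ z x≢z+1 x≢z)) (ℤ.*-zeroʳ (coordFactor up₁ stay₁ y z))

  factor-stay-none : ∀ {y z} → z ≢ y → factor y z y ≡ 0ℤ
  factor-stay-none {y} {z} z≢y = go (z ℤ.≟ y ℤ.+ 1ℤ)
    where
    go : Dec (z ≡ y ℤ.+ 1ℤ) → factor y z y ≡ 0ℤ
    go (yes refl)   = factor-zeroʳ {y} {z} (ℤ.<⇒≢ (i<i+2 y)) (ℤ.<⇒≢ (i<i+1 y))
    go (no  z≢y+1) = factor-zeroˡ {x = y} z≢y+1 z≢y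

  factor-jump : ∀ {y z} → z ≡ y ℤ.+ 1ℤ → factor y z (y ℤ.+ 1ℤ ℤ.+ 1ℤ) ≡ up₁ y ℤ.* up₂ (y ℤ.+ 1ℤ)
  factor-jump {y} refl = cong₂ ℤ._*_ (coordFactor-up up₁ stay₁ y refl) (coordFactor-up up₂ stay₂ (y ℤ.+ 1ℤ) refl)

  factor-jump-none : ∀ {y z} → z ≢ y ℤ.+ 1ℤ → factor y z (y ℤ.+ 1ℤ ℤ.+ 1ℤ) ≡ 0ℤ
  factor-jump-none {y} {z} z≢y+1 = go (z ℤ.≟ y)
    where
    go : Dec (z ≡ y) → factor y z (y ℤ.+ 1ℤ ℤ.+ 1ℤ) ≡ 0ℤ
    go (yes refl) = factor-zeroʳ {y} {y} (≢-sym (ℤ.<⇒≢ (i<i+1 (y ℤ.+ 1ℤ)))) (≢-sym (ℤ.<⇒≢ (i<i+2 y)))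
    go (no  z≢y)  = factor-zeroˡ {x = y ℤ.+ 1ℤ ℤ.+ 1ℤ} z≢y+1 z≢y

  factor-step-stay : ∀ {y z} → z ≡ y → factor y z (y ℤ.+ 1ℤ) ≡ stay₁ y ℤ.* stayFactor (y ℤ.+ 1ℤ)
  factor-step-stay {y} refl = cong₂ ℤ._*_ (coordFactor-stay up₁ stay₁ y refl)
    (trans (coordFactor-up up₂ stay₂ y refl) (up₂≡stay y))

  factor-step-move : ∀ {y z} → z ≡ y ℤ.+ 1ℤ → factor y z (y ℤ.+ 1ℤ) ≡ stay₁ y ℤ.* moveFactor (y ℤ.+ 1ℤ)
  factor-step-move {y} refl = trans
    (cong₂ ℤ._*_ (trans (coordFactor-up up₁ stay₁ y refl) (up₁≡move y))
                 (trans (coordFactor-stay up₂ stay₂ (y ℤ.+ 1ℤ) refl) (sym (stay₁≡stay₂ y))))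
    (ℤ.*-comm (moveFactor (y ℤ.+ 1ℤ)) (stay₁ y))

  -- The block decomposition as an inductive relation.

  NotAdjacent : ∀ {n} → ℤ → Blocks n → Set
  NotAdjacent k (block k′ _ _) = k′ ≢ k
  NotAdjacent k _              = ⊤

  -- The graph of `decompose` for displacements 0, 1, 2, so that later inductions match on
  -- constructors instead of repeating its tests. `start` retains the maximality of the block on its
  -- right end, which is needed when outcomes are shown to be increasing.
  data Decomposition : ∀ {n} → Config n → Config n → Blocks n → Set where
    []    : Decomposition [] [] []
    stay  : ∀ {n y} {ys xs : Config n} {bs} → Site y y →
            Decomposition ys xs bs → Decomposition (y ∷ ys) (y ∷ xs) (fixed y bs)
    jump  : ∀ {n y} {ys xs : Config n} {bs} → Site y (y ℤ.+ 1ℤ ℤ.+ 1ℤ) →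
            Decomposition ys xs bs →
            Decomposition (y ∷ ys) (y ℤ.+ 1ℤ ℤ.+ 1ℤ ∷ xs) (fixed (y ℤ.+ 1ℤ) bs)
    start : ∀ {n y} {ys xs : Config n} {bs} → Site y (y ℤ.+ 1ℤ) →
            NotAdjacent (y ℤ.+ 1ℤ ℤ.+ 1ℤ) bs → Decomposition ys xs bs →
            Decomposition (y ∷ ys) (y ℤ.+ 1ℤ ∷ xs) (block (y ℤ.+ 1ℤ) 1 bs)
    join  : ∀ {n y l} {ys xs : Config (suc l ℕ.+ n)} {bs : Blocks n} → Site y (y ℤ.+ 1ℤ) →
            Decomposition ys xs (block (y ℤ.+ 1ℤ ℤ.+ 1ℤ) (suc l) bs) →
            Decomposition (y ∷ ys) (y ℤ.+ 1ℤ ∷ xs) (block (y ℤ.+ 1ℤ) (suc (suc l)) bs)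

  -- `Blocks` admits blocks of length zero, which `decompose` never produces; without this, the case
  -- of `extend` that lengthens a block would not fit `join`.
  NonemptyHead : ∀ {n} → Blocks n → Set
  NonemptyHead (block _ zero _) = ⊥
  NonemptyHead _                = ⊤

  nonemptyHead : ∀ {n} {y x : Config n} {bs} → Decomposition y x bs → NonemptyHead bs
  nonemptyHead []            = tt
  nonemptyHead (stay _ _)    = tt
  nonemptyHead (jump _ _)    = tt
  nonemptyHead (start _ _ _) = tt
  nonemptyHead (join _ _)    = tt

  extend-decomposition : ∀ {n y} {ys xs : Config n} bs → Site y (y ℤ.+ 1ℤ) →
    Decomposition ys xs bs → Decomposition (y ∷ ys) (y ℤ.+ 1ℤ ∷ xs) (extend (y ℤ.+ 1ℤ) bs)
  extend-decomposition []           s d = start s tt d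
  extend-decomposition (fixed _ _)  s d = start s tt d
  extend-decomposition {y = y} (block k l bs) s d with k ℤ.≟ y ℤ.+ 1ℤ ℤ.+ 1ℤ
  extend-decomposition (block k zero bs)    s d | yes refl = ⊥-elim (nonemptyHead d)
  extend-decomposition (block k (suc l) bs) s d | yes refl = join s d
  ... | no k≢ = start s k≢ d

  decomposition : ∀ {n} {y x : Config n} → Pointwise Site y x → Pointwise Displacement y x →
                  Decomposition y x (decompose y x)
  decomposition [] [] = []
  decomposition {y = y ∷ _} (s ∷ ss) (inj₁ refl ∷ ds) rewrite dec-true (y ℤ.≟ y) refl =
    stay s (decomposition ss ds)
  decomposition {y = y ∷ _} (s ∷ ss) (inj₂ (inj₁ refl) ∷ ds)
    rewrite dec-false (y ℤ.+ 1ℤ ℤ.≟ y) (≢-sym (ℤ.<⇒≢ (i<i+1 y)))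
          | dec-true (y ℤ.+ 1ℤ ℤ.≟ y ℤ.+ 1ℤ) refl =
    extend-decomposition _ s (decomposition ss ds)
  decomposition {y = y ∷ _} (s ∷ ss) (inj₂ (inj₂ refl) ∷ ds)
    rewrite dec-false (y ℤ.+ 1ℤ ℤ.+ 1ℤ ℤ.≟ y) (≢-sym (ℤ.<⇒≢ (i<i+2 y)))
          | dec-false (y ℤ.+ 1ℤ ℤ.+ 1ℤ ℤ.≟ y ℤ.+ 1ℤ) (≢-sym (ℤ.<⇒≢ (i<i+1 (y ℤ.+ 1ℤ)))) =
    jump s (decomposition ss ds)

  -- The weight of ξ = 0 may vanish at the right boundary, but the terms with ξ > 0 add up to
  -- `stayFactor k` times the mass of the shorter block, which is positive. Nonnegativity of the
  -- weight of ξ = 0 is carried in `Admissible` for this induction.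
  admissible-suc : ∀ {n} k l (bs : Blocks n) → 0ℤ ℤ.≤ moveFactor k → 0ℤ ℤ.< stayFactor k →
    Admissible (block (k ℤ.+ 1ℤ) l bs) → Admissible (block k (suc l) bs)
  admissible-suc k l bs move≥0 stay>0 (w≥0 , Z>0 , adm) = 0≤i*j move≥0 w≥0 , mass>0 , adm
    where
    w′ : Fin (suc l) → ℚ
    w′ ξ = fromℤ (blockWeight (k ℤ.+ 1ℤ) l (toℕ ξ))
    mass-eq : blockMass k (suc l)
      ≡ fromℤ (blockWeight k (suc l) 0) ℚ.+ fromℤ (stayFactor k) ℚ.* blockMass (k ℤ.+ 1ℤ) l
    mass-eq = trans (∑-allFin-suc (suc l) (λ ξ → fromℤ (blockWeight k (suc l) (toℕ ξ))))
      (cong (fromℤ (blockWeight k (suc l) 0) ℚ.+_)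
        (trans (∑-cong (List.allFin (suc l)) (λ ξ → fromℤ-* (stayFactor k) (blockWeight (k ℤ.+ 1ℤ) l (toℕ ξ))))
               (∑-distribˡ (List.allFin (suc l)) (fromℤ (stayFactor k)) w′)))
    mass>0 : 0ℚ ℚ.< blockMass k (suc l)
    mass>0 = subst (0ℚ ℚ.<_) (sym mass-eq)
      (ℚ.+-mono-≤-< (fromℤ-nonNeg (0≤i*j move≥0 w≥0)) (0<p*q (fromℤ-pos stay>0) Z>0))

  admissible : ∀ {n} {y x : Config n} {bs} → Decomposition y x bs → Admissible bs
  admissible []                    = tt
  admissible (stay _ d)            = admissible d
  admissible (jump _ d)            = admissible d
  admissible (start {y = y} {bs = bs} s _ d) = admissible-suc (y ℤ.+ 1ℤ) 0 bs (move≥0 s) (stay>0 s)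
    (ℤ.+≤+ z≤n , ℚ.positive⁻¹ _ , admissible d)
  admissible (join {y = y} {l} {bs = bs} s d) =
    admissible-suc (y ℤ.+ 1ℤ) (suc l) bs (move≥0 s) (stay>0 s) (admissible d)

  -- Proportionality of path weights to the unnormalised law.

  Proportional : ∀ {n} → Config n → Config n → Blocks n → Set
  Proportional y x bs = ∃[ κ ] 0ℚ ℚ.< κ ×
    (∀ z → Linked ℤ._<_ z → fromℤ (factors y z x) ≡ κ ℚ.* integral bs (δ z))

  factors-∷ : ∀ {n} {ys xs zs : Config n} {bs} y z x {a i} κ → factor y z x ≡ a →
    fromℤ (factors ys zs xs) ≡ κ ℚ.* integral bs (δ zs) →
    fromℤ a ℚ.* integral bs (δ zs) ≡ i → fromℤ (factors (y ∷ ys) (z ∷ zs) (x ∷ xs)) ≡ κ ℚ.* i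
  factors-∷ {ys = ys} {xs} {zs} {bs} y z x {a} {i} κ eq ih ai = begin
    fromℤ (factor y z x ℤ.* factors ys zs xs)  ≡⟨ fromℤ-* (factor y z x) (factors ys zs xs) ⟩
    fromℤ (factor y z x) ℚ.* fromℤ (factors ys zs xs) ≡⟨ cong₂ (λ b c → fromℤ b ℚ.* c) eq ih ⟩
    fromℤ a ℚ.* (κ ℚ.* integral bs (δ zs))     ≡⟨ x∙yz≈y∙xz *-comm-semigroup (fromℤ a) κ _ ⟩
    κ ℚ.* (fromℤ a ℚ.* integral bs (δ zs))     ≡⟨ cong (κ ℚ.*_) ai ⟩
    κ ℚ.* i                                    ∎
    where open ≡-Reasoning

  proportional-fixed : ∀ {n} {ys xs : Config n} {bs} y x a {c} → 0ℤ ℤ.< c →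
    (∀ {z} → z ≡ a → factor y z x ≡ c) → (∀ {z} → z ≢ a → factor y z x ≡ 0ℤ) →
    Proportional ys xs bs → Proportional (y ∷ ys) (x ∷ xs) (fixed a bs)
  proportional-fixed {ys = ys} {xs} {bs} y x a {c} c>0 hit miss (κ , κ>0 , ih) =
    κ ℚ.* fromℤ c , 0<p*q κ>0 (fromℤ-pos c>0) , λ { (z ∷ zs) lz → go z zs lz (z ℤ.≟ a) }
    where
    go : ∀ z zs → Linked ℤ._<_ (z ∷ zs) → Dec (z ≡ a) →
      fromℤ (factors (y ∷ ys) (z ∷ zs) (x ∷ xs)) ≡ κ ℚ.* fromℤ c ℚ.* integral (fixed a bs) (δ (z ∷ zs))
    go z zs lz (yes z≡a) = trans
      (factors-∷ {ys = ys} {xs} {bs = bs} y z x κ (hit z≡a) (ih zs (proj₂ (unlink lz)))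
        (cong (fromℤ c ℚ.*_) (sym (integral-δ-∷ bs a {zs = zs} (sym z≡a)))))
      (sym (ℚ.*-assoc κ (fromℤ c) (integral (fixed a bs) (δ (z ∷ zs)))))
    go z zs lz (no z≢a) = trans
      (factors-∷ {ys = ys} {xs} {bs = bs} y z x κ (miss z≢a) (ih zs (proj₂ (unlink lz)))
        (trans (ℚ.*-zeroˡ (integral bs (δ zs))) (sym (trans (cong (fromℤ c ℚ.*_) (integral-δ-∷-≢ bs (λ as → as) {zs = zs} (≢-sym z≢a)))
          (ℚ.*-zeroʳ (fromℤ c))))))
      (sym (ℚ.*-assoc κ (fromℤ c) (integral (fixed a bs) (δ (z ∷ zs)))))

  proportional-block : ∀ {n l} {ys xs : Config (l ℕ.+ n)} {bs : Blocks n} y →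
    Site y (y ℤ.+ 1ℤ) → Proportional ys xs (block (y ℤ.+ 1ℤ ℤ.+ 1ℤ) l bs) →
    Proportional (y ∷ ys) (y ℤ.+ 1ℤ ∷ xs) (block (y ℤ.+ 1ℤ) (suc l) bs)
  proportional-block {l = l} {ys} {xs} {bs} y s (κ , κ>0 , ih) =
    κ ℚ.* fromℤ c , 0<p*q κ>0 (fromℤ-pos c>0) ,
    λ { (z ∷ zs) lz → trans (go z zs lz (z ℤ.≟ y) (z ℤ.≟ k))
          (sym (ℚ.*-assoc κ (fromℤ c) (integral (block k (suc l) bs) (δ (z ∷ zs))))) }
    where
    k = y ℤ.+ 1ℤ
    c = stay₁ y
    c>0 : 0ℤ ℤ.< c
    c>0 = subst (0ℤ ℤ.<_) (sym (stay₁≡stay₂ y)) (stay₂>0 s)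
    pull : ∀ a i j → j ≡ fromℤ a ℚ.* i → fromℤ (c ℤ.* a) ℚ.* i ≡ fromℤ c ℚ.* j
    pull a i j eq = trans (cong (ℚ._* i) (fromℤ-* c a))
      (trans (ℚ.*-assoc (fromℤ c) (fromℤ a) i) (cong (fromℤ c ℚ.*_) (sym eq)))
    go : ∀ z zs → Linked ℤ._<_ (z ∷ zs) → Dec (z ≡ y) → Dec (z ≡ k) →
      fromℤ (factors (y ∷ ys) (z ∷ zs) (k ∷ xs))
        ≡ κ ℚ.* (fromℤ c ℚ.* integral (block k (suc l) bs) (δ (z ∷ zs)))
    go z zs lz (yes refl) _ =
      factors-∷ {ys = ys} {xs} {bs = block (k ℤ.+ 1ℤ) l bs} y z k κ (factor-step-stay {y} refl) (ih zs (proj₂ (unlink lz)))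
        (pull (stayFactor k) (integral (block (k ℤ.+ 1ℤ) l bs) (δ zs)) _
          (integral-δ-stay k l bs {zs = zs} (sym (i+1-1≡i y))))
    go z zs lz (no _) (yes refl) =
      factors-∷ {ys = ys} {xs} {bs = block (k ℤ.+ 1ℤ) l bs} y z k κ (factor-step-move {y} refl) (ih zs (proj₂ (unlink lz)))
        (pull (moveFactor k) (integral (block (k ℤ.+ 1ℤ) l bs) (δ zs)) _
          (integral-δ-move k l bs (proj₁ (unlink lz))))
    go z zs lz (no z≢y) (no z≢k) =
      factors-∷ {ys = ys} {xs} {bs = block (k ℤ.+ 1ℤ) l bs} y z k κ (factor-zeroˡ {y} {x = k} z≢k z≢y) (ih zs (proj₂ (unlink lz)))
        (trans (ℚ.*-zeroˡ (integral (block (k ℤ.+ 1ℤ) l bs) (δ zs)))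
          (sym (trans (cong (fromℤ c ℚ.*_)
            (integral-δ-none k l bs {zs = zs} (λ eq → z≢y (trans eq (i+1-1≡i y))) z≢k)) (ℚ.*-zeroʳ (fromℤ c)))))

  -- The value of κ never matters, since it cancels against the normaliser; its positivity is what
  -- makes the normaliser positive. Increasing `z` is essential: inside a block, a moving particle
  -- followed by a staying one can have a nonzero product of factors but is never sampled.
  proportional : ∀ {n} {y x : Config n} {bs} → Decomposition y x bs → Proportional y x bs
  proportional [] = 1ℚ , ℚ.positive⁻¹ 1ℚ , λ { [] _ → refl }
  proportional (stay {y = y} {ys} {xs} {bs} s d) =
    proportional-fixed {bs = bs} y y y κ>0 factor-stay factor-stay-none (proportional d)
    where
    κ>0 : 0ℤ ℤ.< stay₁ y ℤ.* stay₂ y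
    κ>0 = 0<i*j (subst (0ℤ ℤ.<_) (sym (stay₁≡stay₂+1 y)) (0<i+1 (ℤ.<⇒≤ (stay₂>0 s)))) (stay₂>0 s)
  proportional (jump {y = y} {bs = bs} s d) =
    proportional-fixed {bs = bs} y _ (y ℤ.+ 1ℤ) κ>0 factor-jump factor-jump-none (proportional d)
    where
    κ>0 : 0ℤ ℤ.< up₁ y ℤ.* up₂ (y ℤ.+ 1ℤ)
    -- The bound `move≥0` holds at x = y + 2, while `up₁ y` is the factor `moveFactor` at y + 1; the
    -- unit between them makes the inequality strict.
    κ>0 = 0<i*j
      (subst (0ℤ ℤ.<_) (sym (trans (up₁≡move y) (move-pred (y ℤ.+ 1ℤ)))) (0<i+1 (move≥0 s)))
      (subst (0ℤ ℤ.<_) (sym (up₂≡stay (y ℤ.+ 1ℤ))) (stay>0 s))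
  proportional (start {y = y} {ys} {xs} {bs} s _ d) with proportional d
  -- A new block is grown out of a block of length zero, whose insertion does not change the law.
  ... | κ , κ>0 , ih = proportional-block {l = 0} {bs = bs} y s (κ , κ>0 , λ z lz →
    trans (ih z lz) (cong (κ ℚ.*_) (sym (integral-block-zero (y ℤ.+ 1ℤ ℤ.+ 1ℤ) bs (δ z)))))
  proportional (join {y = y} {l} {bs = bs} s d) = proportional-block {l = suc l} {bs = bs} y s (proportional d)

  -- The support of the law lies in the configuration space.

  outcome-block-zero : ∀ {n k} {bs : Blocks n} {a} → Outcome (block k 0 bs) a → Outcome bs a
  outcome-block-zero (Fin.zero , zs , _ , refl , o) = o

  Moved Stayed : ∀ {n} → ℤ → ∀ l → Blocks n → Config (suc l ℕ.+ n) → Set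
  Moved k l bs a = ∃[ zs ] moveFactor k ≢ 0ℤ ×
    a ≡ k ∷ moveBlock (k ℤ.+ 1ℤ) l 0 ++ zs × Outcome (block (k ℤ.+ 1ℤ) l bs) (moveBlock (k ℤ.+ 1ℤ) l 0 ++ zs)
  Stayed k l bs a = ∃[ as ] a ≡ k ℤ.- 1ℤ ∷ as × Outcome (block (k ℤ.+ 1ℤ) l bs) as

  -- The counterpart of `integral-block-suc` on supports: a nonzero product has nonzero factors.
  -- `Moved` keeps the nonvanishing of `moveFactor k`, which later supplies the room at the right
  -- boundary.
  outcome-block-suc : ∀ {n} k l (bs : Blocks n) {a} → Outcome (block k (suc l) bs) a →
                      Moved k l bs a ⊎ Stayed k l bs a
  outcome-block-suc k l bs (Fin.zero , zs , w≢0 , a≡ , o) = inj₁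
    (zs , (λ m≡0 → w≢0 (trans (cong (ℤ._* w) m≡0) (ℤ.*-zeroˡ w))) ,
     trans a≡ (cong (_++ zs) (moveBlock-zero k l)) ,
     Fin.zero , zs , (λ w≡0 → w≢0 (trans (cong (moveFactor k ℤ.*_) w≡0) (ℤ.*-zeroʳ (moveFactor k)))) , refl , o)
    where w = blockWeight (k ℤ.+ 1ℤ) l 0
  outcome-block-suc k l bs (Fin.suc ξ , zs , w≢0 , a≡ , o) = inj₂
    (moveBlock (k ℤ.+ 1ℤ) l (toℕ ξ) ++ zs , trans a≡ (cong (_++ zs) (moveBlock-suc k l (toℕ ξ))) ,
     ξ , zs , (λ w≡0 → w≢0 (trans (cong (stayFactor k ℤ.*_) w≡0) (ℤ.*-zeroʳ (stayFactor k)))) , refl , o)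

  inSection : ∀ z → 0ℤ ℤ.≤ z → z ℤ.≤ + suc t ℤ.+ + N ℤ.- 1ℤ → 0ℤ ℤ.≤ stay₂ z → 0ℤ ℤ.≤ up₁ z →
              InSection N T S′ (suc t) z
  inSection z z≥0 z≤t+N lower upper =
    ℤ.⊔-lub z≥0 (ℤ.0≤i-j⇒j≤i (subst (0ℤ ℤ.≤_) (ringˡ z (+ T) (+ suc t) (+ S′)) lower)) ,
    ℤ.⊓-glb z≤t+N (ℤ.0≤i-j⇒j≤i (subst (0ℤ ℤ.≤_) (ringᵘ z (+ N) (+ S′)) upper))
    where
    ringˡ : ∀ z T t s → z ℤ.+ T ℤ.- t ℤ.- s ≡ z ℤ.- (t ℤ.+ s ℤ.- T)
    ringˡ = solve-∀
    ringᵘ : ∀ z n s → n ℤ.+ s ℤ.- z ℤ.- 1ℤ ≡ s ℤ.+ n ℤ.- 1ℤ ℤ.- z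
    ringᵘ = solve-∀

  private
    next : + t ℤ.+ + N ℤ.- 1ℤ ℤ.+ 1ℤ ≡ + suc t ℤ.+ + N ℤ.- 1ℤ
    next = ring (+ t) (+ N)
      where
      ring : ∀ t n → t ℤ.+ n ℤ.- 1ℤ ℤ.+ 1ℤ ≡ 1ℤ ℤ.+ t ℤ.+ n ℤ.- 1ℤ
      ring = solve-∀

  inSection-stay : ∀ {y x} → Site y x → 0ℤ ℤ.≤ stay₂ y → InSection N T S′ (suc t) y
  inSection-stay {y} s lower = inSection y (y≥0 s)
    (subst (y ℤ.≤_) next (ℤ.≤-trans (y≤t+N-1 s) (ℤ.<⇒≤ (i<i+1 _)))) lower (up₁≥0 s)

  inSection-move : ∀ {y x} → Site y x → 0ℤ ℤ.≤ up₁ (y ℤ.+ 1ℤ) → InSection N T S′ (suc t) (y ℤ.+ 1ℤ)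
  inSection-move {y} s upper = inSection (y ℤ.+ 1ℤ) (ℤ.<⇒≤ (0<i+1 (y≥0 s)))
    (subst (y ℤ.+ 1ℤ ℤ.≤_) next (ℤ.+-monoˡ-≤ 1ℤ (y≤t+N-1 s)))
    (subst (0ℤ ℤ.≤_) (stay₁≡stay₂ y) (stay₁≥0 s)) upper

  -- Serves particles with x = y + 2: there x itself occupies y + 2, so no later block can start at
  -- that site.
  notAdjacent-below : ∀ {n k} {ys xs : Config n} {bs} → Decomposition ys xs bs → Below k xs → NotAdjacent k bs
  notAdjacent-below []            _   = tt
  notAdjacent-below (stay _ _)    _   = tt
  notAdjacent-below (jump _ _)    _   = tt
  notAdjacent-below (start _ _ _) k<x = ≢-sym (ℤ.<⇒≢ k<x)
  notAdjacent-below (join _ _)    k<x = ≢-sym (ℤ.<⇒≢ k<x)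

  -- A particle arriving at y + 1 could only collide with a right neighbour already at y + 1 that
  -- does not leave. If that neighbour had x = y + 1, the bound on `xs` would fail; if it belonged
  -- to a block, the block would start at y + 2, against non-adjacency.
  below-next : ∀ {n y} {ys xs zs : Config n} {bs} → Decomposition ys xs bs → Outcome bs zs →
    NotAdjacent (y ℤ.+ 1ℤ ℤ.+ 1ℤ) bs → Pointwise ℤ._≤_ ys zs →
    Below y ys → Below (y ℤ.+ 1ℤ) xs → Below (y ℤ.+ 1ℤ) zs
  below-next []            _              _  []         _    _     = tt
  below-next (stay _ _)    (_ , refl , _) _  _          _    y+1<x = y+1<x
  below-next (jump _ _)    (_ , refl , _) _  _          y<y′ _     = ℤ.+-monoˡ-< 1ℤ y<y′
  below-next (start _ _ _) _              k≢ (y′≤z ∷ _) y<y′ _     =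
    ℤ.<-≤-trans (ℤ.≤∧≢⇒< (<⇒+1≤ y<y′) (λ eq → k≢ (cong (ℤ._+ 1ℤ) (sym eq)))) y′≤z
  below-next (join _ _)    _              k≢ (y′≤z ∷ _) y<y′ _     =
    ℤ.<-≤-trans (ℤ.≤∧≢⇒< (<⇒+1≤ y<y′) (λ eq → k≢ (cong (ℤ._+ 1ℤ) (sym eq)))) y′≤z

  -- `above` strengthens the induction: a particle that stays is to the left of its neighbour's old
  -- position, hence of its new one.
  record Valid {n} (y z : Config n) : Set where
    constructor valid
    field
      linked  : Linked ℤ._<_ z
      inside  : All (InSection N T S′ (suc t)) z
      above   : Pointwise ℤ._≤_ y z

  outcome-valid : ∀ {n} {y x z : Config n} {bs} → Decomposition y x bs →
                  Linked ℤ._<_ y → Linked ℤ._<_ x → Outcome bs z → Valid y z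
  outcome-stayed : ∀ {n y} {ys zs : Config n} → Site y (y ℤ.+ 1ℤ) → Below y ys → Valid ys zs →
                   Valid (y ∷ ys) (y ∷ zs)
  -- Nonzero weight pays off here: a nonnegative integer factor that does not vanish is at least 1,
  -- and it exceeds `up₁` at y + 1 by exactly 1, so y + 1 respects the right boundary for S - 1.
  outcome-moved : ∀ {n y} {ys zs : Config n} → Site y (y ℤ.+ 1ℤ) → moveFactor (y ℤ.+ 1ℤ) ≢ 0ℤ →
                  Below (y ℤ.+ 1ℤ) zs → Valid ys zs → Valid (y ∷ ys) (y ℤ.+ 1ℤ ∷ zs)

  outcome-stayed {y = y} s y<ys (valid l a p) = valid (below-≤ y<ys p ∷ˡ l)
    -- The strict bound on `stay₂` is at x = y + 1; one site to the left it becomes the weak bound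
    -- that the left boundary asks for.
    (inSection-stay s (0<i+1⇒0≤i (subst (0ℤ ℤ.<_) (trans (sym (stay₁≡stay₂ y)) (stay₁≡stay₂+1 y)) (stay₂>0 s))) ∷ a)
    (ℤ.≤-refl ∷ p)

  outcome-moved {y = y} s m≢0 y+1<zs (valid l a p) = valid (y+1<zs ∷ˡ l)
    (inSection-move s (0<i+1⇒0≤i (subst (0ℤ ℤ.<_) (trans (move-pred (y ℤ.+ 1ℤ)) (cong (ℤ._+ 1ℤ) (sym (up₁≡move (y ℤ.+ 1ℤ)))))
      (ℤ.≤∧≢⇒< (move≥0 s) (≢-sym m≢0)))) ∷ a)
    (ℤ.<⇒≤ (i<i+1 y) ∷ p)

  outcome-valid {z = []} [] _ _ _ = valid [] [] []
  outcome-valid (stay s d) ly lx (zs , refl , o) with unlink ly | unlink lx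
  ... | y<ys , lys | x<xs , lxs with outcome-valid d lys lxs o
  ... | valid l a p = valid (below-≤ y<ys p ∷ˡ l)
    (inSection-stay s (ℤ.<⇒≤ (stay₂>0 s)) ∷ a) (ℤ.≤-refl ∷ p)
  outcome-valid (jump {y = y} s d) ly lx (zs , refl , o) with unlink ly | unlink lx
  ... | y<ys , lys | x<xs , lxs with outcome-valid d lys lxs o
  ... | valid l a p = valid
    (below-next d o (notAdjacent-below d x<xs) p y<ys (weaken x<xs) ∷ˡ l)
    (inSection-move s (subst (0ℤ ℤ.≤_) (sym (up₁≡move (y ℤ.+ 1ℤ))) (move≥0 s)) ∷ a)
    (ℤ.<⇒≤ (i<i+1 y) ∷ p)
    where
    weaken : ∀ {n} {xs : Config n} → Below (y ℤ.+ 1ℤ ℤ.+ 1ℤ) xs → Below (y ℤ.+ 1ℤ) xs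
    weaken {xs = []}    _ = tt
    weaken {xs = _ ∷ _}   = ℤ.<-trans (i<i+1 (y ℤ.+ 1ℤ))
  outcome-valid (start {y = y} {ys} {bs = bs} s na d) ly lx o with unlink ly | unlink lx
  ... | y<ys , lys | x<xs , lxs with outcome-block-suc (y ℤ.+ 1ℤ) 0 bs o
  ... | inj₁ (zs , m≢0 , refl , o′) = outcome-moved s m≢0
    (below-next d (outcome-block-zero {k = y ℤ.+ 1ℤ ℤ.+ 1ℤ} {bs} o′) na (Valid.above v) y<ys x<xs) v
    where v = outcome-valid d lys lxs (outcome-block-zero {k = y ℤ.+ 1ℤ ℤ.+ 1ℤ} {bs} o′)
  ... | inj₂ (zs , refl , o′) = subst (λ i → Valid (y ∷ ys) (i ∷ zs)) (sym (i+1-1≡i y))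
    (outcome-stayed s y<ys (outcome-valid d lys lxs (outcome-block-zero {k = y ℤ.+ 1ℤ ℤ.+ 1ℤ} {bs} o′)))
  outcome-valid (join {y = y} {l} {ys} {bs = bs} s d) ly lx o with unlink ly | unlink lx
  ... | y<ys , lys | x<xs , lxs with outcome-block-suc (y ℤ.+ 1ℤ) (suc l) bs o
  ... | inj₁ (zs , m≢0 , refl , o′) = outcome-moved s m≢0
    -- The next particle of the block has moved too; `moveBlock` places it at its own start plus
    -- zero.
    (subst (y ℤ.+ 1ℤ ℤ.<_) (sym (ℤ.+-identityʳ _)) (i<i+1 (y ℤ.+ 1ℤ))) (outcome-valid d lys lxs o′)
  ... | inj₂ (zs , refl , o′) = subst (λ i → Valid (y ∷ ys) (i ∷ zs)) (sym (i+1-1≡i y))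
    (outcome-stayed s y<ys (outcome-valid d lys lxs o′))

-- Positive prefactors and the enumeration of configurations.

vandermonde-pos : ∀ {n} {z : Config n} → Linked ℤ._<_ z → 0ℤ ℤ.< vandermonde z
vandermonde-pos {z = []}    _ = ℤ.+<+ (s≤s z≤n)
vandermonde-pos {z = z ∷ zs} l = 0<i*j (differences zs (below-all (proj₁ (unlink l)) (proj₂ (unlink l))))
                                       (vandermonde-pos (proj₂ (unlink l)))
  where
  below-all : ∀ {n} {zs : Config n} → Below z zs → Linked ℤ._<_ zs → All (z ℤ.<_) zs
  below-all {zs = []}    _    _ = []
  below-all {zs = _ ∷ _} z<zs l = Linked.Linked⇒All ℤ.<-trans z<zs l
  differences : ∀ {n} (zs : Config n) → All (z ℤ.<_) zs → 0ℤ ℤ.< ∏ᵥ (Vec.map (ℤ._- z) zs)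
  differences []       []         = ℤ.+<+ (s≤s z≤n)
  differences (_ ∷ zs) (z< ∷ z<s) = 0<i*j (i<j⇒0<j-i z<) (differences zs z<s)

poch-pos : ∀ {a} k → 0ℤ ℤ.< a → 0ℤ ℤ.< poch a k
poch-pos zero    _   = ℤ.+<+ (s≤s z≤n)
poch-pos (suc k) 0<a = 0<i*j (poch-pos k 0<a) (ℤ.+-mono-<-≤ 0<a (ℤ.+≤+ (z≤n {k})))

tuples-unique : ∀ {A : Set} n {xs : List A} → Unique xs → Unique (tuples n xs)
tuples-unique zero    _ = ListAll.[] AllPairs.∷ AllPairs.[]
tuples-unique (suc n) u = Unique.cartesianProductWith⁺ _∷_ ∷-injective u (tuples-unique n u)

∈-tuples : ∀ {A : Set} {n} {xs : List A} {v : Vec A n} → All (_∈ xs) v → v ∈ tuples n xs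
∈-tuples []       = here refl
∈-tuples (p ∷ ps) = ∈-cartesianProductWith⁺ _∷_ p (∈-tuples ps)

configs-unique : ∀ N T S t → Unique (configs N T S t)
configs-unique N T S t = Unique.filter⁺ (linked? ℤ._<?_) (tuples-unique N
  (Unique.filter⁺ (inSection? N T S t) (Unique.map⁺ ℤ.+-injective (Unique.upTo⁺ (S ℕ.+ N)))))

∈-section : ∀ N T S t {z} → InSection N T S t z → z ∈ section N T S t
∈-section N T S t {+ m} ins = ∈-filter⁺ (inSection? N T S t)
  (∈-map⁺ +_ (∈-upTo⁺ (ℤ.drop‿+<+ (+1≤⇒< (subst (+ m ℤ.+ 1ℤ ℤ.≤_) (i-1+1≡i (+ (S ℕ.+ N)))
    (ℤ.+-monoˡ-≤ 1ℤ (ℤ.≤-trans (proj₂ ins) (ℤ.i⊓j≤j (+ t ℤ.+ + N ℤ.- 1ℤ) (+ S ℤ.+ + N ℤ.- 1ℤ))))))))) ins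
∈-section N T S t {ℤ.-[1+ m ]} (0≤z , _) =
  contradiction (ℤ.≤-trans (ℤ.i≤i⊔j 0ℤ (+ t ℤ.+ + S ℤ.- + T)) 0≤z) (λ ())

∈-configs : ∀ N T S t {z} → Linked ℤ._<_ z → All (InSection N T S t) z → z ∈ configs N T S t
∈-configs N T S t l ins = ∈-filter⁺ (linked? ℤ._<?_) (∈-tuples (All.map (∈-section N T S t) ins)) l

-- One step of the algorithm against one factor of the Markov step.

module _ (N S′ T t : ℕ) (t<T : t ℕ.< T) (S′<T : S′ ℕ.< T) where

  open Kernel N (suc S′) t
  open Step N S′ T t

  private
    den₁ = poch (+ T ℤ.- + t) N
    den₂ = poch (+ T ℤ.- + S′) N
    den₁>0 : 0ℤ ℤ.< den₁
    den₁>0 = poch-pos N (i<j⇒0<j-i (ℤ.+<+ t<T))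
    den₂>0 : 0ℤ ℤ.< den₂
    den₂>0 = poch-pos N (i<j⇒0<j-i (ℤ.+<+ S′<T))

  pathWeight : Config N → Config N → Config N → ℚ
  pathWeight y z x = P-t+ N T S′ t y z ℚ.* P-S+ N T S′ (suc t) z x

  -- What the two prefactors leave behind once the determinant of the intermediate configuration is
  -- gone; like κ, it does not depend on that configuration.
  scale : Config N → Config N → ℚ
  scale y x = fromℤ (vandermonde x) ⊘ fromℤ (den₁ ℤ.* vandermonde y ℤ.* den₂)

  scale-pos : ∀ {y x} → Linked ℤ._<_ y → Linked ℤ._<_ x → 0ℚ ℚ.< scale y x
  scale-pos ly lx = ⊘-pos (fromℤ-pos (vandermonde-pos lx))
    (fromℤ-pos (0<i*j (0<i*j den₁>0 (vandermonde-pos ly)) den₂>0))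

  -- The Vandermonde determinant of z cancels.
  pathWeight-factors : ∀ {y z} x → Linked ℤ._<_ y → Linked ℤ._<_ z →
    pathWeight y z x ≡ scale y x ℚ.* fromℤ (factors y z x)
  pathWeight-factors {y} {z} x ly lz = *-cancelʳ {r = b ℚ.* d} (pos⇒≢0 (0<p*q b>0 d>0)) (begin
    (a ⊘ b) ℚ.* (c ⊘ d) ℚ.* (b ℚ.* d)        ≡⟨ interchange *-comm-semigroup (a ⊘ b) (c ⊘ d) b d ⟩
    (a ⊘ b) ℚ.* b ℚ.* ((c ⊘ d) ℚ.* d)        ≡⟨ cong₂ ℚ._*_ (⊘-* a (pos⇒≢0 b>0)) (⊘-* c (pos⇒≢0 d>0)) ⟩
    a ℚ.* c                                  ≡⟨ fromℤ-* (V z ℤ.* f) (V x ℤ.* g) ⟨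
    fromℤ (V z ℤ.* f ℤ.* (V x ℤ.* g))        ≡⟨ cong fromℤ (ring₁ (V z) f (V x) g) ⟩
    fromℤ (V x ℤ.* (f ℤ.* g ℤ.* V z))        ≡⟨ cong (λ i → fromℤ (V x ℤ.* (i ℤ.* V z))) (factors-∏ y z x) ⟩
    fromℤ (V x ℤ.* (F ℤ.* V z))              ≡⟨ trans (fromℤ-* (V x) (F ℤ.* V z)) (cong (fromℤ (V x) ℚ.*_) (fromℤ-* F (V z))) ⟩
    fromℤ (V x) ℚ.* (fromℤ F ℚ.* fromℤ (V z)) ≡⟨ cong (ℚ._* (fromℤ F ℚ.* fromℤ (V z))) (⊘-* (fromℤ (V x)) (pos⇒≢0 e>0)) ⟨
    scale y x ℚ.* e ℚ.* (fromℤ F ℚ.* fromℤ (V z)) ≡⟨ interchange *-comm-semigroup (scale y x) e (fromℤ F) (fromℤ (V z)) ⟩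
    scale y x ℚ.* fromℤ F ℚ.* (e ℚ.* fromℤ (V z)) ≡⟨ cong (scale y x ℚ.* fromℤ F ℚ.*_) denominators ⟩
    scale y x ℚ.* fromℤ F ℚ.* (b ℚ.* d)      ∎)
    where
    open ≡-Reasoning
    V : Config N → ℤ
    V = vandermonde
    F = factors y z x
    f = ∏ᵥ (Vec.zipWith (coordFactor up₁ stay₁) y z)
    g = ∏ᵥ (Vec.zipWith (coordFactor up₂ stay₂) z x)
    a = fromℤ (V z ℤ.* f)
    b = fromℤ (den₁ ℤ.* V y)
    c = fromℤ (V x ℤ.* g)
    d = fromℤ (den₂ ℤ.* V z)
    e = fromℤ (den₁ ℤ.* V y ℤ.* den₂)
    b>0 : 0ℚ ℚ.< b
    b>0 = fromℤ-pos (0<i*j den₁>0 (vandermonde-pos ly))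
    d>0 : 0ℚ ℚ.< d
    d>0 = fromℤ-pos (0<i*j den₂>0 (vandermonde-pos lz))
    e>0 : 0ℚ ℚ.< e
    e>0 = fromℤ-pos (0<i*j (0<i*j den₁>0 (vandermonde-pos ly)) den₂>0)
    ring₁ : ∀ a b c d → a ℤ.* b ℤ.* (c ℤ.* d) ≡ c ℤ.* (b ℤ.* d ℤ.* a)
    ring₁ = solve-∀
    ring₂ : ∀ a b c d → a ℤ.* b ℤ.* c ℤ.* d ≡ a ℤ.* b ℤ.* (c ℤ.* d)
    ring₂ = solve-∀
    denominators : e ℚ.* fromℤ (V z) ≡ b ℚ.* d
    denominators = trans (sym (fromℤ-* (den₁ ℤ.* V y ℤ.* den₂) (V z)))
      (trans (cong fromℤ (ring₂ den₁ (V y) den₂ (V z))) (fromℤ-* (den₁ ℤ.* V y) (den₂ ℤ.* V z)))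

  step-law : ∀ {y x} → Pointwise Site y x → Pointwise Displacement y x →
    Linked ℤ._<_ y → Linked ℤ._<_ x →
    0ℚ ℚ.< P-t+S+ N T S′ t y x ×
    (∀ z → Linked ℤ._<_ z → pathWeight y z x
      ≡ Prob _≟ᶜ_ (algorithmStep N (suc S′) t y x) z ℚ.* P-t+S+ N T S′ t y x)
  step-law {y} {x} sites disps ly lx with proportional (decomposition sites disps)
  ... | κ , κ>0 , factors≡ =
    subst (0ℚ ℚ.<_) (sym normaliser) (0<p*q c>0 (mass-pos bs adm)) ,
    λ z lz → begin
      pathWeight y z x                                ≡⟨ weight≡ z lz ⟩
      c ℚ.* integral bs (δ z)                         ≡⟨ cong (c ℚ.*_) (𝔼-sampleBlocks bs adm (δ z)) ⟨
      c ℚ.* (𝔼 step (δ z) ℚ.* mass bs)                ≡⟨ x∙yz≈y∙xz *-comm-semigroup c (𝔼 step (δ z)) (mass bs) ⟩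
      𝔼 step (δ z) ℚ.* (c ℚ.* mass bs)                ≡⟨ cong₂ ℚ._*_ (sym (Prob≡𝔼 _≟ᶜ_ step z)) (sym normaliser) ⟩
      Prob _≟ᶜ_ step z ℚ.* P-t+S+ N T S′ t y x        ∎
    where
    open ≡-Reasoning
    bs = decompose y x
    step = algorithmStep N (suc S′) t y x
    dec = decomposition sites disps
    adm = admissible dec
    zs = configs N T S′ (suc t)
    c = scale y x ℚ.* κ
    c>0 : 0ℚ ℚ.< c
    c>0 = 0<p*q (scale-pos ly lx) κ>0
    weight≡ : ∀ z → Linked ℤ._<_ z → pathWeight y z x ≡ c ℚ.* integral bs (δ z)
    weight≡ z lz = trans (pathWeight-factors x ly lz)
      (trans (cong (scale y x ℚ.*_) (factors≡ z lz)) (sym (ℚ.*-assoc (scale y x) κ (integral bs (δ z)))))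
    -- Each outcome in the support is enumerated exactly once, so after the sum is moved inside the
    -- integral the integrand is 1 wherever it counts.
    support : ∀ {a} → Outcome bs a → ∑ zs (λ z → δ z a) ≡ 1ℚ
    support o = let valid l ins _ = outcome-valid dec ly lx o in
      ∑-ind-∈ _≟ᶜ_ (configs-unique N T S′ (suc t)) (∈-configs N T S′ (suc t) l ins)
    normaliser : P-t+S+ N T S′ t y x ≡ c ℚ.* mass bs
    normaliser = begin
      ∑ zs (λ z → pathWeight y z x)
        ≡⟨ ∑-cong-∈ zs (λ {z} z∈ → weight≡ z (proj₂ (∈-filter⁻ (linked? ℤ._<?_) {xs = tuples N (section N T S′ (suc t))} z∈))) ⟩
      ∑ zs (λ z → c ℚ.* integral bs (δ z))
        ≡⟨ ∑-distribˡ zs c (λ z → integral bs (δ z)) ⟩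
      c ℚ.* ∑ zs (λ z → integral bs (δ z))
        ≡⟨ cong (c ℚ.*_) (integral-∑ bs zs δ) ⟨
      c ℚ.* integral bs (λ a → ∑ zs (λ z → δ z a))
        ≡⟨ cong (c ℚ.*_) (integral-cong-Outcome bs support) ⟩
      c ℚ.* mass bs ∎

-- Sequences

module _ {N : ℕ} (S : ℕ) where

  algorithmFrom-head : ∀ {n} t (y z : Config N) (xs : Vec (Config N) n) (zs : Vec (Config N) n) → y ≢ z →
    Prob _≟ˢ_ (algorithmFrom N S t y xs) (z ∷ zs) ≡ 0ℚ
  algorithmFrom-head t y z [] [] y≢z = trans (Prob≡𝔼 _≟ˢ_ (algorithmFrom N S t y []) (z ∷ []))
    (trans (𝔼-return (y ∷ []) (λ b → ind (b ≟ˢ (z ∷ [])))) (ind-no ((y ∷ []) ≟ˢ (z ∷ [])) (y≢z ∘ ∷-injectiveˡ)))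
  algorithmFrom-head t y z (x ∷ xs) zs y≢z = trans (Prob≡𝔼 _≟ˢ_ (algorithmFrom N S t y (x ∷ xs)) (z ∷ zs))
    (trans (𝔼->>= step tail-law g) (trans (𝔼-cong step λ a →
      trans (𝔼->>= (algorithmFrom N S (suc t) a xs) (λ as → return (y ∷ as)) g)
        (trans (𝔼-cong (algorithmFrom N S (suc t) a xs) λ as → trans (𝔼-return (y ∷ as) g)
                 (ind-no ((y ∷ as) ≟ˢ (z ∷ zs)) (y≢z ∘ ∷-injectiveˡ)))
               (𝔼-zero (algorithmFrom N S (suc t) a xs)))) (𝔼-zero step)))
    where
    step = algorithmStep N S t y x
    tail-law = λ (a : Config N) → algorithmFrom N S (suc t) a xs >>= λ as → return (y ∷ as)
    g = λ (b : Vec (Config N) _) → ind (b ≟ˢ (z ∷ zs))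

  -- The Markov property. A continuation repeats its starting point, so draws other than `z`
  -- contribute nothing, and the law of the rest comes out as a constant factor.
  algorithmFrom-∷ : ∀ {n} t (y z x : Config N) (xs zs : Vec (Config N) n) →
    Prob _≟ˢ_ (algorithmFrom N S t y (x ∷ xs)) (y ∷ z ∷ zs)
      ≡ Prob _≟ᶜ_ (algorithmStep N S t y x) z ℚ.* Prob _≟ˢ_ (algorithmFrom N S (suc t) z xs) (z ∷ zs)
  algorithmFrom-∷ t y z x xs zs = begin
    Prob _≟ˢ_ (algorithmFrom N S t y (x ∷ xs)) (y ∷ z ∷ zs)
      ≡⟨ Prob≡𝔼 _≟ˢ_ (algorithmFrom N S t y (x ∷ xs)) (y ∷ z ∷ zs) ⟩
    𝔼 (algorithmFrom N S t y (x ∷ xs)) g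
      ≡⟨ 𝔼->>= step (λ a → from a >>= λ as → return (y ∷ as)) g ⟩
    𝔼 step (λ a → 𝔼 (from a >>= λ as → return (y ∷ as)) g)
      ≡⟨ 𝔼-cong step inner ⟩
    𝔼 step (λ a → ind (a ≟ᶜ z) ℚ.* Prob _≟ˢ_ (from z) (z ∷ zs))
      ≡⟨ 𝔼-* step (λ a → ind (a ≟ᶜ z)) (Prob _≟ˢ_ (from z) (z ∷ zs)) ⟩
    𝔼 step (λ a → ind (a ≟ᶜ z)) ℚ.* Prob _≟ˢ_ (from z) (z ∷ zs)
      ≡⟨ cong (ℚ._* Prob _≟ˢ_ (from z) (z ∷ zs)) (Prob≡𝔼 _≟ᶜ_ step z) ⟨
    Prob _≟ᶜ_ step z ℚ.* Prob _≟ˢ_ (from z) (z ∷ zs) ∎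
    where
    open ≡-Reasoning
    step = algorithmStep N S t y x
    from = λ a → algorithmFrom N S (suc t) a xs
    g = λ (b : Vec (Config N) _) → ind (b ≟ˢ (y ∷ z ∷ zs))
    p = Prob _≟ˢ_ (from z) (z ∷ zs)
    unfold : ∀ a → 𝔼 (from a >>= λ as → return (y ∷ as)) g ≡ Prob _≟ˢ_ (from a) (z ∷ zs)
    unfold a = trans (𝔼->>= (from a) (λ as → return (y ∷ as)) g)
      (trans (𝔼-cong (from a) (λ as → trans (𝔼-return (y ∷ as) g)
               (ind-⇔ ((y ∷ as) ≟ˢ (y ∷ z ∷ zs)) (as ≟ˢ (z ∷ zs)) ∷-injectiveʳ (cong (y ∷_)))))
             (sym (Prob≡𝔼 _≟ˢ_ (from a) (z ∷ zs))))
    pick : ∀ a → Dec (a ≡ z) → Prob _≟ˢ_ (from a) (z ∷ zs) ≡ ind (a ≟ᶜ z) ℚ.* p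
    pick a (yes refl) = sym (trans (cong (ℚ._* p) (ind-yes (a ≟ᶜ z) refl)) (ℚ.*-identityˡ p))
    pick a (no a≢z)   = trans (algorithmFrom-head (suc t) a z xs zs a≢z)
      (sym (trans (cong (ℚ._* p) (ind-no (a ≟ᶜ z) a≢z)) (ℚ.*-zeroˡ p)))
    inner : ∀ a → 𝔼 (from a >>= λ as → return (y ∷ as)) g ≡ ind (a ≟ᶜ z) ℚ.* p
    inner a = trans (unfold a) (pick a (a ≟ᶜ z))

∏-allFin-suc : ∀ n (f : Fin (suc n) → ℚ) →
  ∏ (List.allFin (suc n)) f ≡ f Fin.zero ℚ.* ∏ (List.allFin n) (f ∘ Fin.suc)
∏-allFin-suc n f = cong (f Fin.zero ℚ.*_)
  (trans (cong (λ xs → ∏ xs f) (sym (List.map-tabulate (λ i → i) Fin.suc))) (∏-map Fin.suc (List.allFin n) f))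

∏-cong : ∀ {A : Set} (xs : List A) {f g : A → ℚ} → (∀ x → f x ≡ g x) → ∏ xs f ≡ ∏ xs g
∏-cong []       f≗g = refl
∏-cong (x ∷ xs) f≗g = cong₂ ℚ._*_ (f≗g x) (∏-cong xs f≗g)

coordFactor-≢0 : ∀ up stay x y → coordFactor up stay x y ≢ 0ℤ → UpStep x y
coordFactor-≢0 up stay x y ≢0 = go (y ℤ.≟ x ℤ.+ 1ℤ) (y ℤ.≟ x)
  where
  go : Dec (y ≡ x ℤ.+ 1ℤ) → Dec (y ≡ x) → UpStep x y
  go (yes p) _       = inj₂ p
  go (no  _) (yes p) = inj₁ p
  go (no ¬p) (no ¬q) = contradiction (coordFactor-none up stay x ¬p ¬q) ≢0

coordFactors-≢0 : ∀ up stay {n} (x y : Config n) → ∏ᵥ (Vec.zipWith (coordFactor up stay) x y) ≢ 0ℤ →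
                  Pointwise UpStep x y
coordFactors-≢0 up stay []       []       _  = []
coordFactors-≢0 up stay (x ∷ xs) (y ∷ ys) ≢0 =
  coordFactor-≢0 up stay x y (λ c≡0 → ≢0 (trans (cong (ℤ._* cs) c≡0) (ℤ.*-zeroˡ cs))) ∷
  coordFactors-≢0 up stay xs ys (λ cs≡0 → ≢0 (trans (cong (c ℤ.*_) cs≡0) (ℤ.*-zeroʳ c)))
  where
  c = coordFactor up stay x y
  cs = ∏ᵥ (Vec.zipWith (coordFactor up stay) xs ys)

transition-≢0 : ∀ up stay den {n} (x y : Config n) → transition up stay den x y ≢ 0ℚ → Pointwise UpStep x y
transition-≢0 up stay den x y ≢0 = coordFactors-≢0 up stay x y λ c≡0 → ≢0 (trans
  (cong (_⊘ fromℤ (den ℤ.* vandermonde x)) (cong fromℤ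
    (trans (cong (vandermonde y ℤ.*_) c≡0) (ℤ.*-zeroʳ (vandermonde y)))))
  (0⊘ (fromℤ (den ℤ.* vandermonde x))))

displacements : ∀ {n} {y x₀ x : Config n} → Pointwise UpStep y x₀ → Pointwise UpStep x₀ x →
  Pointwise (Displacement) y x
displacements []        []        = []
displacements (p ∷ ps) (q ∷ qs) = one p q ∷ displacements ps qs
  where
  one : ∀ {y x₀ x} → UpStep y x₀ → UpStep x₀ x → Displacement y x
  one (inj₁ refl) (inj₁ refl) = inj₁ refl
  one (inj₁ refl) (inj₂ refl) = inj₂ (inj₁ refl)
  one (inj₂ refl) (inj₁ refl) = inj₂ (inj₁ refl)
  one (inj₂ refl) (inj₂ refl) = inj₂ (inj₂ refl)

module _ (N S′ T : ℕ) (S′<T : S′ ℕ.< T) where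

  -- What membership of the two sequences in their path spaces gives at one time. Closeness of `y`
  -- to `x₀` is absent because it does not follow from membership; `sequence-law` carries it along.
  record Stage (t : ℕ) (y z x₀ x : Config N) : Set where
    field
      t<T     : t ℕ.< T
      sites   : Pointwise (Step.Site N S′ T t) y x
      linkedʸ : Linked ℤ._<_ y
      linkedᶻ : Linked ℤ._<_ z
      linkedˣ : Linked ℤ._<_ x
      upSteps : Pointwise UpStep x₀ x

  data Stages : ∀ {n} → ℕ → Vec (Config N) (suc n) → Vec (Config N) (suc n) → Set where
    []  : ∀ {t y x} → Stages t (y ∷ []) (x ∷ [])
    _∷_ : ∀ {t n y z x₀ x} {zs xs : Vec (Config N) n} → Stage t y z x₀ x →
          Stages (suc t) (z ∷ zs) (x ∷ xs) → Stages t (y ∷ z ∷ zs) (x₀ ∷ x ∷ xs)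

  stages : ∀ {n} t (Y X : Vec (Config N) (suc n)) →
    (∀ (i : Fin n) → Stage (t ℕ.+ toℕ i) (lookup Y (inject₁ i)) (lookup Y (Fin.suc i))
                                         (lookup X (inject₁ i)) (lookup X (Fin.suc i))) →
    Stages t Y X
  stages t (y ∷ [])     (x ∷ [])      _ = []
  stages t (y ∷ z ∷ zs) (x₀ ∷ x ∷ xs) s =
    subst (λ u → Stage u y z x₀ x) (ℕ.+-identityʳ t) (s Fin.zero) ∷
    stages (suc t) (z ∷ zs) (x ∷ xs) (λ i → subst
      (λ u → Stage u (lookup (z ∷ zs) (inject₁ i)) (lookup zs i) (lookup (x ∷ xs) (inject₁ i)) (lookup xs i))
      (ℕ.+-suc t (toℕ i)) (s (Fin.suc i)))

  -- The time offset lets the tail of a sequence be treated like the whole; at offset 0 these are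
  -- definitionally the factors in `P-S↦S-1`.
  normaliserAt weightAt : ∀ {n} → ℕ → Vec (Config N) (suc n) → Vec (Config N) n → Fin n → ℚ
  normaliserAt t Y xs i = P-t+S+ N T S′ (t ℕ.+ toℕ i) (lookup Y (inject₁ i)) (lookup xs i)
  weightAt t Y xs i = P-t+ N T S′ (t ℕ.+ toℕ i) (lookup Y (inject₁ i)) (lookup Y (Fin.suc i)) ℚ.*
                      P-S+ N T S′ (suc (t ℕ.+ toℕ i)) (lookup Y (Fin.suc i)) (lookup xs i)

  ratioProduct normaliserProduct : ∀ {n} → ℕ → Vec (Config N) (suc n) → Vec (Config N) n → ℚ
  ratioProduct {n} t Y xs = ∏ (List.allFin n) (λ i → weightAt t Y xs i ⊘ normaliserAt t Y xs i)
  normaliserProduct {n} t Y xs = ∏ (List.allFin n) (normaliserAt t Y xs)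

  module _ {n : ℕ} (t : ℕ) (y z x : Config N) (zs xs : Vec (Config N) n) where

    private
      normaliser = P-t+S+ N T S′ t y x
      weight = P-t+ N T S′ t y z ℚ.* P-S+ N T S′ (suc t) z x

    normaliserProduct-∷ : normaliserProduct t (y ∷ z ∷ zs) (x ∷ xs)
      ≡ normaliser ℚ.* normaliserProduct (suc t) (z ∷ zs) xs
    normaliserProduct-∷ = trans (∏-allFin-suc n (normaliserAt t (y ∷ z ∷ zs) (x ∷ xs)))
      (cong₂ ℚ._*_ (cong (λ u → P-t+S+ N T S′ u y x) (ℕ.+-identityʳ t))
        (∏-cong (List.allFin n) λ i →
          cong (λ u → P-t+S+ N T S′ u (lookup (z ∷ zs) (inject₁ i)) (lookup xs i)) (ℕ.+-suc t (toℕ i))))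

    ratioProduct-∷ : ratioProduct t (y ∷ z ∷ zs) (x ∷ xs)
      ≡ (weight ⊘ normaliser) ℚ.* ratioProduct (suc t) (z ∷ zs) xs
    ratioProduct-∷ = trans
      (∏-allFin-suc n (λ i → weightAt t (y ∷ z ∷ zs) (x ∷ xs) i ⊘ normaliserAt t (y ∷ z ∷ zs) (x ∷ xs) i))
      (cong₂ ℚ._*_
        (cong (λ u → (P-t+ N T S′ u y z ℚ.* P-S+ N T S′ (suc u) z x) ⊘ P-t+S+ N T S′ u y x) (ℕ.+-identityʳ t))
        (∏-cong (List.allFin n) λ i → cong (λ u →
          (P-t+ N T S′ u (lookup (z ∷ zs) (inject₁ i)) (lookup zs i) ℚ.*
           P-S+ N T S′ (suc u) (lookup zs i) (lookup xs i)) ⊘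
          P-t+S+ N T S′ u (lookup (z ∷ zs) (inject₁ i)) (lookup xs i)) (ℕ.+-suc t (toℕ i))))

  -- After a step of probability 0 the normalisers need not be positive, which is
  -- why the second component is a disjunction.
  sequence-law : ∀ {n t} {Y : Vec (Config N) (suc n)} {x₀ xs} → Stages t Y (x₀ ∷ xs) →
    Pointwise UpStep (head Y) x₀ →
    let p = Prob _≟ˢ_ (algorithmFrom N (suc S′) t (head Y) xs) Y in
    p ≡ ratioProduct t Y xs × (0ℚ ℚ.< normaliserProduct t Y xs ⊎ p ≡ 0ℚ)
  sequence-law {t = t} {y ∷ []} [] _ = certain , inj₁ (ℚ.positive⁻¹ 1ℚ)
    where
    certain : Prob _≟ˢ_ (return (y ∷ [])) (y ∷ []) ≡ 1ℚ
    certain = trans (Prob≡𝔼 _≟ˢ_ (return (y ∷ [])) (y ∷ []))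
      (trans (𝔼-return (y ∷ []) (λ b → ind (b ≟ˢ (y ∷ [])))) (ind-yes ((y ∷ []) ≟ˢ (y ∷ [])) refl))
  sequence-law {t = t} (_∷_ {y = y} {z} {x₀} {x} {zs} {xs} s ss) close =
    go (pstep ℚ.≟ 0ℚ)
    where
    open Stage s
    law = step-law N S′ T t t<T S′<T sites (displacements close upSteps) linkedʸ linkedˣ
    pstep = Prob _≟ᶜ_ (algorithmStep N (suc S′) t y x) z
    rest = Prob _≟ˢ_ (algorithmFrom N (suc S′) (suc t) z xs) (z ∷ zs)
    normaliser = P-t+S+ N T S′ t y x
    norm>0 = proj₁ law
    weight = P-t+ N T S′ t y z ℚ.* P-S+ N T S′ (suc t) z x
    weight≡ : weight ≡ pstep ℚ.* normaliser
    weight≡ = proj₂ law z linkedᶻ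
    ratio≡ : weight ⊘ normaliser ≡ pstep
    ratio≡ = ⊘-unique (pos⇒≢0 norm>0) (sym weight≡)
    p = Prob _≟ˢ_ (algorithmFrom N (suc S′) t y (x ∷ xs)) (y ∷ z ∷ zs)
    p≡ : p ≡ pstep ℚ.* rest
    p≡ = algorithmFrom-∷ (suc S′) t y z x xs zs
    go : Dec (pstep ≡ 0ℚ) → p ≡ ratioProduct t (y ∷ z ∷ zs) (x ∷ xs) ×
      (0ℚ ℚ.< normaliserProduct t (y ∷ z ∷ zs) (x ∷ xs) ⊎ p ≡ 0ℚ)
    -- One vanishing ratio annihilates the product, whatever values `⊘` takes at later times.
    go (yes pstep≡0) = trans p≡0 (sym (trans (ratioProduct-∷ t y z x zs xs)
      (trans (cong (ℚ._* ratioProduct (suc t) (z ∷ zs) xs) (trans ratio≡ pstep≡0)) (ℚ.*-zeroˡ (ratioProduct (suc t) (z ∷ zs) xs))))) , inj₂ p≡0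
      where
      p≡0 : p ≡ 0ℚ
      p≡0 = trans p≡ (trans (cong (ℚ._* rest) pstep≡0) (ℚ.*-zeroˡ rest))
    go (no pstep≢0) = trans p≡ (trans (cong₂ ℚ._*_ (sym ratio≡) (proj₁ ih)) (sym (ratioProduct-∷ t y z x zs xs))) ,
      positive (proj₂ ih)
      where
      z↦x : P-S+ N T S′ (suc t) z x ≢ 0ℚ
      z↦x P≡0 = pstep≢0 (*-cancelʳ (pos⇒≢0 norm>0) (trans (sym weight≡)
        (trans (cong (P-t+ N T S′ t y z ℚ.*_) P≡0)
          (trans (ℚ.*-zeroʳ (P-t+ N T S′ t y z)) (sym (ℚ.*-zeroˡ normaliser))))))
      ih = sequence-law ss (transition-≢0 _ _ (poch (+ T ℤ.- + S′) N) z x z↦x)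
      positive : 0ℚ ℚ.< normaliserProduct (suc t) (z ∷ zs) xs ⊎ rest ≡ 0ℚ →
        0ℚ ℚ.< normaliserProduct t (y ∷ z ∷ zs) (x ∷ xs) ⊎ p ≡ 0ℚ
      positive (inj₁ 0<∏)   = inj₁ (subst (0ℚ ℚ.<_) (sym (normaliserProduct-∷ t y z x zs xs)) (0<p*q norm>0 0<∏))
      positive (inj₂ rest≡0) = inj₂ (trans p≡ (trans (cong (pstep ℚ.*_) rest≡0) (ℚ.*-zeroʳ pstep)))

-- Bounds along a lattice path.

UpSteps : ∀ {n} → (Fin (suc n) → ℤ) → Set
UpSteps {n} τ = ∀ (t : Fin n) → UpStep (τ (inject₁ t)) (τ (Fin.suc t))

upStep-≤ : ∀ {x y} → UpStep x y → x ℤ.≤ y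
upStep-≤ (inj₁ refl) = ℤ.≤-refl
upStep-≤ (inj₂ refl) = ℤ.<⇒≤ (i<i+1 _)

upStep-≤+1 : ∀ {x y} → UpStep x y → y ℤ.≤ x ℤ.+ 1ℤ
upStep-≤+1 (inj₁ refl) = ℤ.<⇒≤ (i<i+1 _)
upStep-≤+1 (inj₂ refl) = ℤ.≤-refl

path-≤start+t : ∀ {n} (τ : Fin (suc n) → ℤ) → UpSteps τ → ∀ t → τ t ℤ.≤ τ Fin.zero ℤ.+ + toℕ t
path-≤start+t τ s Fin.zero = ℤ.≤-reflexive (sym (ℤ.+-identityʳ _))
path-≤start+t {suc n} τ s (Fin.suc t) = ℤ.≤-trans (path-≤start+t (τ ∘ Fin.suc) (s ∘ Fin.suc) t)
  (subst (τ (Fin.suc Fin.zero) ℤ.+ + toℕ t ℤ.≤_) (ℤ.+-assoc (τ Fin.zero) 1ℤ (+ toℕ t))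
    (ℤ.+-monoˡ-≤ (+ toℕ t) (upStep-≤+1 (s Fin.zero))))

start≤path : ∀ {n} (τ : Fin (suc n) → ℤ) → UpSteps τ → ∀ t → τ Fin.zero ℤ.≤ τ t
start≤path τ s Fin.zero = ℤ.≤-refl
start≤path {suc n} τ s (Fin.suc t) =
  ℤ.≤-trans (upStep-≤ (s Fin.zero)) (start≤path (τ ∘ Fin.suc) (s ∘ Fin.suc) t)

path≤end : ∀ {n} (τ : Fin (suc n) → ℤ) → UpSteps τ → ∀ t → τ t ℤ.≤ τ (fromℕ n)
path≤end {zero}  τ s Fin.zero    = ℤ.≤-refl
path≤end {suc n} τ s Fin.zero    = start≤path τ s (fromℕ (suc n))
path≤end {suc n} τ s (Fin.suc t) = path≤end (τ ∘ Fin.suc) (s ∘ Fin.suc) t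

-- After time t at most n - t upward steps remain; both sides are shifted to avoid truncated
-- subtraction.
end+t≤path+n : ∀ {n} (τ : Fin (suc n) → ℤ) → UpSteps τ → ∀ t →
               τ (fromℕ n) ℤ.+ + toℕ t ℤ.≤ τ t ℤ.+ + n
end+t≤path+n {n} τ s Fin.zero = ℤ.≤-trans (ℤ.≤-reflexive (ℤ.+-identityʳ (τ (fromℕ n))))
  (subst (λ m → τ (fromℕ n) ℤ.≤ τ Fin.zero ℤ.+ + m) (Fin.toℕ-fromℕ n) (path-≤start+t τ s (fromℕ n)))
end+t≤path+n {suc n} τ s (Fin.suc t) = subst₂ ℤ._≤_
  (shift (τ (fromℕ (suc n))) (+ toℕ t)) (shift (τ (Fin.suc t)) (+ n))
  (ℤ.+-monoˡ-≤ 1ℤ (end+t≤path+n (τ ∘ Fin.suc) (s ∘ Fin.suc) t))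
  where
  shift : ∀ a b → a ℤ.+ b ℤ.+ 1ℤ ≡ a ℤ.+ (1ℤ ℤ.+ b)
  shift = solve-∀

pointwise : ∀ {n} {R : ℤ → ℤ → Set} {xs ys : Config n} →
            (∀ i → R (lookup xs i) (lookup ys i)) → Pointwise R xs ys
pointwise {xs = []}    {[]}    _ = []
pointwise {xs = _ ∷ _} {_ ∷ _} r = r Fin.zero ∷ pointwise (r ∘ Fin.suc)

increasing⇒linked : ∀ {n} {xs : Config n} →
  (∀ i j → i Fin.< j → lookup xs i ℤ.< lookup xs j) → Linked ℤ._<_ xs
increasing⇒linked {xs = []}         _ = []
increasing⇒linked {xs = _ ∷ []}     _ = [-]
increasing⇒linked {xs = _ ∷ _ ∷ _} r =
  r Fin.zero (Fin.suc Fin.zero) (s≤s z≤n) ∷ increasing⇒linked (λ i j i<j → r (Fin.suc i) (Fin.suc j) (s≤s i<j))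

module Path {N T S : ℕ} {X : Sequence N T} (ω : Ω N T S X) where
  open Ω ω

  path : Fin N → Fin (suc T) → ℤ
  path i t = lookup (lookup X t) i

  upSteps : ∀ i → UpSteps (path i)
  upSteps i t with step t i
  ... | inj₁ d≡0 = inj₁ (ℤ.i-j≡0⇒i≡j _ _ d≡0)
  ... | inj₂ d≡1 = inj₂ (trans (ring (path i (Fin.suc t)) (path i (inject₁ t))) (cong (ℤ._+_ (path i (inject₁ t))) d≡1))
    where
    ring : ∀ a b → a ≡ b ℤ.+ (a ℤ.- b)
    ring = solve-∀

  linked : ∀ t → Linked ℤ._<_ (lookup X t)
  linked t = increasing⇒linked (strict t)

  i≤path : ∀ i t → + toℕ i ℤ.≤ path i t
  i≤path i t = subst (ℤ._≤ path i t) (start i) (start≤path (path i) (upSteps i) t)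

  path≤i+t : ∀ i t → path i t ℤ.≤ + toℕ i ℤ.+ + toℕ t
  path≤i+t i t = subst (λ a → path i t ℤ.≤ a ℤ.+ + toℕ t) (start i) (path-≤start+t (path i) (upSteps i) t)

  path≤S+i : ∀ i t → path i t ℤ.≤ + S ℤ.+ + toℕ i
  path≤S+i i t = subst (path i t ℤ.≤_) (end i) (path≤end (path i) (upSteps i) t)

  S+i+t≤path+T : ∀ i t → + S ℤ.+ + toℕ i ℤ.+ + toℕ t ℤ.≤ path i t ℤ.+ + T
  S+i+t≤path+T i t = subst (λ a → a ℤ.+ + toℕ t ℤ.≤ path i t ℤ.+ + T) (end i) (end+t≤path+n (path i) (upSteps i) t)

-- From path families to the hypotheses of each step, and the conclusion.

module _ (N S′ T : ℕ) (S′<T : S′ ℕ.< T) {X Y : Sequence N T} (ωX : Ω N T (suc S′) X) (ωY : Ω N T S′ Y) where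

  private
    module X = Path ωX
    module Y = Path ωY

  -- Each bound combines the slope of a single path, measured from one of its endpoints, with 0 ≤ i
  -- ≤ N - 1. `stay₂>0` is strict because the path of X ends one unit further right than the
  -- parameter of the factor; `stay>0` is strict because that factor is the upward one at x - 1.
  site : ∀ (t : Fin T) i → Step.Site N S′ T (toℕ t) (Y.path i (inject₁ t)) (X.path i (Fin.suc t))
  site t i = record
    { y≥0     = ℤ.≤-trans (ℤ.+≤+ z≤n) (Y.i≤path i (inject₁ t))
    ; y≤t+N-1 = ℤ.0≤i-j⇒j≤i (subst (0ℤ ℤ.≤_) (ring₁ (+ toℕ i) u n y) (ℤ.+-mono-≤ y≤i+t i+1≤N))
    ; stay₁≥0 = subst (0ℤ ℤ.≤_) (ring₂ (+ toℕ i) u s y (+ T)) (ℤ.+-mono-≤ S+i+t≤y+T i≥0)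
    ; up₁≥0   = subst (0ℤ ℤ.≤_) (ring₃ (+ toℕ i) n s y) (ℤ.+-mono-≤ (ℤ.i≤j⇒0≤j-i (Y.path≤S+i i (inject₁ t))) i+1≤N)
    ; stay₂>0 = subst (0ℤ ℤ.<_) (ring₄ (+ toℕ i) u s x (+ T))
                  (0<i+1 (ℤ.+-mono-≤ (ℤ.i≤j⇒0≤j-i (X.S+i+t≤path+T i (Fin.suc t))) i≥0))
    ; move≥0  = subst (0ℤ ℤ.≤_) (ring₅ (+ toℕ i) n s x) (ℤ.+-mono-≤ (ℤ.i≤j⇒0≤j-i (X.path≤S+i i (Fin.suc t))) i+1≤N)
    ; stay>0  = subst (0ℤ ℤ.<_) (ring₆ (+ toℕ i) u n x)
                  (0<i+1 (ℤ.+-mono-≤ (ℤ.i≤j⇒0≤j-i (X.path≤i+t i (Fin.suc t))) i+1≤N))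
    }
    where
    n = + N
    s = + S′
    u = + toℕ t
    y = Y.path i (inject₁ t)
    x = X.path i (Fin.suc t)
    i≥0 : 0ℤ ℤ.≤ + toℕ i
    i≥0 = ℤ.+≤+ z≤n
    i+1≤N : 0ℤ ℤ.≤ n ℤ.- (1ℤ ℤ.+ + toℕ i)
    i+1≤N = ℤ.i≤j⇒0≤j-i (ℤ.+≤+ (Fin.toℕ<n i))
    y≤i+t : 0ℤ ℤ.≤ + toℕ i ℤ.+ u ℤ.- y
    y≤i+t = subst (λ m → 0ℤ ℤ.≤ + toℕ i ℤ.+ + m ℤ.- y) (Fin.toℕ-inject₁ t) (ℤ.i≤j⇒0≤j-i (Y.path≤i+t i (inject₁ t)))
    S+i+t≤y+T : 0ℤ ℤ.≤ y ℤ.+ + T ℤ.- (s ℤ.+ + toℕ i ℤ.+ u)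
    S+i+t≤y+T = subst (λ m → 0ℤ ℤ.≤ y ℤ.+ + T ℤ.- (s ℤ.+ + toℕ i ℤ.+ + m)) (Fin.toℕ-inject₁ t)
      (ℤ.i≤j⇒0≤j-i (Y.S+i+t≤path+T i (inject₁ t)))
    ring₁ : ∀ i u n y → i ℤ.+ u ℤ.- y ℤ.+ (n ℤ.- (1ℤ ℤ.+ i)) ≡ u ℤ.+ n ℤ.- 1ℤ ℤ.- y
    ring₁ = solve-∀
    ring₂ : ∀ i u s y T → y ℤ.+ T ℤ.- (s ℤ.+ i ℤ.+ u) ℤ.+ i ≡ y ℤ.+ T ℤ.- u ℤ.- s
    ring₂ = solve-∀
    ring₃ : ∀ i n s y → s ℤ.+ i ℤ.- y ℤ.+ (n ℤ.- (1ℤ ℤ.+ i)) ≡ n ℤ.+ s ℤ.- y ℤ.- 1ℤ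
    ring₃ = solve-∀
    ring₄ : ∀ i u s x T → x ℤ.+ T ℤ.- (1ℤ ℤ.+ s ℤ.+ i ℤ.+ (1ℤ ℤ.+ u)) ℤ.+ i ℤ.+ 1ℤ ≡ x ℤ.+ T ℤ.- (1ℤ ℤ.+ u) ℤ.- s
    ring₄ = solve-∀
    ring₅ : ∀ i n s x → 1ℤ ℤ.+ s ℤ.+ i ℤ.- x ℤ.+ (n ℤ.- (1ℤ ℤ.+ i)) ≡ n ℤ.+ (1ℤ ℤ.+ s) ℤ.- x ℤ.- 1ℤ
    ring₅ = solve-∀
    ring₆ : ∀ i u n x → i ℤ.+ (1ℤ ℤ.+ u) ℤ.- x ℤ.+ (n ℤ.- (1ℤ ℤ.+ i)) ℤ.+ 1ℤ ≡ n ℤ.+ u ℤ.- x ℤ.+ 1ℤ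
    ring₆ = solve-∀

  stage : ∀ (t : Fin T) → Stage N S′ T S′<T (toℕ t) (lookup Y (inject₁ t)) (lookup Y (Fin.suc t))
                                                    (lookup X (inject₁ t)) (lookup X (Fin.suc t))
  stage t = record
    { t<T     = Fin.toℕ<n t
    ; sites   = pointwise (site t)
    ; linkedʸ = Y.linked (inject₁ t)
    ; linkedᶻ = Y.linked (Fin.suc t)
    ; linkedˣ = X.linked (Fin.suc t)
    ; upSteps = pointwise (λ i → X.upSteps i t)
    }

-- For a sequence of probability zero both branches of the Markov step agree, so the positivity test
-- need not be decided.
if-zero : ∀ b {p q : ℚ} → p ≡ 0ℚ → q ≡ p → p ≡ (if b then q else 0ℚ)
if-zero true  _   q≡p = sym q≡p
if-zero false p≡0 _   = p≡0

theorem4p2 : (N T S : ℕ) → 1 ≤ N → 1 ≤ T → 1 ≤ S → S ≤ T →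
    (X : Sequence N T) → Ω N T S X →
    (Y′ : Sequence N T) → Ω N T (S ∸ 1) Y′ →
    Prob _≟ˢ_ (algorithm N T S X) Y′ ≡ P-S↦S-1 N T S X Y′
theorem4p2 N T (suc S′) _ _ _ S′<T (x₀ ∷ xs) ωX (y₀ ∷ ys) ωY = conclude (proj₁ law) (proj₂ law)
  where
  Y = y₀ ∷ ys
  law = sequence-law N S′ T S′<T (stages N S′ T S′<T 0 Y (x₀ ∷ xs) (stage N S′ T S′<T ωX ωY))
    -- Both families start at (0, ..., N-1), so closeness holds at time zero with no displacement.
    (pointwise (λ i → inj₁ (trans (Ω.start ωX i) (sym (Ω.start ωY i)))))
  y₀≡initial : y₀ ≡ tabulate (λ i → + toℕ i)
  y₀≡initial = trans (sym (tabulate∘lookup y₀)) (tabulate-cong (Ω.start ωY))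
  p = Prob _≟ˢ_ (algorithmFrom N (suc S′) 0 y₀ xs) Y
  p≡ : Prob _≟ˢ_ (algorithm N T (suc S′) (x₀ ∷ xs)) Y ≡ p
  p≡ = cong (λ y → Prob _≟ˢ_ (algorithmFrom N (suc S′) 0 y xs) Y) (sym y₀≡initial)
  ∏norm = normaliserProduct N S′ T S′<T 0 Y xs
  conclude : p ≡ ratioProduct N S′ T S′<T 0 Y xs → 0ℚ ℚ.< ∏norm ⊎ p ≡ 0ℚ →
    Prob _≟ˢ_ (algorithm N T (suc S′) (x₀ ∷ xs)) Y ≡ P-S↦S-1 N T (suc S′) (x₀ ∷ xs) Y
  conclude p≡ratio (inj₁ ∏>0) = trans p≡ (trans p≡ratio
    (sym (cong (if_then ratioProduct N S′ T S′<T 0 Y xs else 0ℚ) (dec-true (0ℚ ℚ.<? ∏norm) ∏>0))))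
  conclude p≡ratio (inj₂ p≡0) = trans p≡ (if-zero (does (0ℚ ℚ.<? ∏norm)) p≡0 (sym p≡ratio))
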